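{- In IITT, if $\Gamma\vdash t:T$ and $\Gamma\vdash t:T'$ then $\Gamma\vdash T=T'$.
   Context: Irrelevant Intensional Type Theory (IITT) is defined as follows. Sorts are $\mathsf{Set}_k$ ($k\in\mathbb{N}$), with $\mathsf{Axiom}=\{(\mathsf{Set}_i,\mathsf{Set}_{i+1})\mid i\in\mathbb{N}\}$ and $\mathsf{Rule}=\{(\mathsf{Set}_i,\mathsf{Set}_j,\mathsf{Set}_{\max(i,j)})\mid i,j\in\mathbb{N}\}$. Annotations are $\star\in\{:,\div\}$ (relevant, irrelevant). Expressions: $t,u,T,U ::= s \mid (x\star U)\to^{s,s'}T \mid x \mid \lambda x\star U.\,t \mid t\star u$, where $(x\star U)\to^{s,s'}T$ is a relevant or irrelevant dependent function type annotated with the sort $s$ of its domain and $s'$ of its codomain, and $t\star u$ is relevant application (also written $t\,u$) or irrelevant application $t\div u$. Expressions are taken modulo $\alpha$-equivalence; $[u/x]t$ is capture-avoiding substitution. Contexts: $\Gamma ::= () \mid \Gamma.\,x\star T$ (variables distinct). Resurrection $\Gamma^{\oplus}$ replaces each binding $x\div T$ by $x:T$. Abbreviations: $\Gamma\vdash t\div T$ means $\Gamma^\oplus\vdash t:T$; $\Gamma\vdash t=t'\div T$ means $\Gamma\vdash t\div T$ and $\Gamma\vdash t'\div T$; $\Gamma\vdash T$ means $\Gamma\vdash T:s$ for some sort $s$; $\Gamma\vdash T=T'$ means $\Gamma\vdash T=T':s$ for some $s$. The judgements $\vdash\Gamma$, $\Gamma\vdash t:T$, $\Gamma\vdash t=t':T$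 are defined mutually inductively by: (contexts) $\vdash()$; from $\vdash\Gamma$ and $\Gamma\vdash T$ infer $\vdash\Gamma.x\star T$. (typing) from $\vdash\Gamma$, $(s,s')\in\mathsf{Axiom}$ infer $\Gamma\vdash s:s'$; from $\Gamma\vdash U:s_1$, $\Gamma.x\star U\vdash T:s_2$, $(s_1,s_2,s_3)\in\mathsf{Rule}$ infer $\Gamma\vdash (x\star U)\to^{s_1,s_2}T:s_3$; from $\vdash\Gamma$ and $(x:U)\in\Gamma$ infer $\Gamma\vdash x:U$ (no variable rule for irrelevant bindings); from $\Gamma.x\star U\vdash t:T$ and $\Gamma\vdash (x\star U)\to^{s,s'}T$ infer $\Gamma\vdash \lambda x\star U.t:(x\star U)\to^{s,s'}T$; from $\Gamma\vdash t:(x\star U)\to^{s,s'}T$ and $\Gamma\vdash u\star U$ infer $\Gamma\vdash t\star u:[u/x]T$; from $\Gamma\vdash t:T$ and $\Gamma\vdash T=T'$ infer $\Gamma\vdash t:T'$. (equality) $\beta$: from $\Gamma.x\star U\vdash t:T$ and $\Gamma\vdash u\star U$ infer $\Gamma\vdash(\lambda x\star U.t)\star u=[u/x]t:[u/x]T$; $\eta$: from $\Gamma\vdash t:(x\star U)\to^{s,s'}T$ infer $\Gamma\vdash t=\lambda x\star U.(t\star x):(x\star U)\to^{s,s'}T$; reflexivity, symmetry, transitivity; from $\Gamma\vdash U=U':s_1$, $\Gamma.x\star U\vdash T=T':s_2$, $(s_1,s_2,s_3)\in\mathsf{Rule}$ infer $\Gamma\vdash (x\star U)\to^{s_1,s_2}T=(x\star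 U')\to^{s_1,s_2}T':s_3$; from $\Gamma\vdash U=U':s_1$, $\Gamma.x\star U\vdash T:s_2$, $\Gamma.x\star U\vdash t=t':T$ infer $\Gamma\vdash\lambda x\star U.t=\lambda x\star U'.t':(x\star U)\to^{s_1,s_2}T$; from $\Gamma\vdash t=t':(x\star U)\to^{s,s'}T$ and $\Gamma\vdash u=u'\star U$ infer $\Gamma\vdash t\star u=t'\star u':[u/x]T$; from $\Gamma\vdash t=t':T$ and $\Gamma\vdash T=T'$ infer $\Gamma\vdash t=t':T'$. -}

module Defs where

open import Data.Nat using (ℕ; zero; suc; _⊔_)
open import Data.Product using (Σ; ∃; _,_)

data Ann : Set where
  rel irr : Ann

-- Expressions.  The sort Set_k is represented as  sort k.
--   pi a i j U T   is  (x ⋆ U) →^{Set_i , Set_j} T   (x bound in T as var 0)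
--   lam a U t      is  λ x ⋆ U . t                    (x bound in t as var 0)
--   app a t u      is  t ⋆ u
data Tm : Set where
  sort : ℕ → Tm
  pi   : Ann → ℕ → ℕ → Tm → Tm → Tm
  var  : ℕ → Tm
  lam  : Ann → Tm → Tm → Tm
  app  : Ann → Tm → Tm → Tm

liftRen : (ℕ → ℕ) → ℕ → ℕ
liftRen ρ zero    = zero
liftRen ρ (suc n) = suc (ρ n)

ren : (ℕ → ℕ) → Tm → Tm
ren ρ (sort k)      = sort k
ren ρ (pi a i j U T) = pi a i j (ren ρ U) (ren (liftRen ρ) T)
ren ρ (var x)       = var (ρ x)
ren ρ (lam a U t)   = lam a (ren ρ U) (ren (liftRen ρ) t)
ren ρ (app a t u)   = app a (ren ρ t) (ren ρ u)

wk : Tm → Tm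
wk = ren suc

liftSub : (ℕ → Tm) → ℕ → Tm
liftSub σ zero    = var zero
liftSub σ (suc n) = wk (σ n)

sub : (ℕ → Tm) → Tm → Tm
sub σ (sort k)       = sort k
sub σ (pi a i j U T) = pi a i j (sub σ U) (sub (liftSub σ) T)
sub σ (var x)        = σ x
sub σ (lam a U t)    = lam a (sub σ U) (sub (liftSub σ) t)
sub σ (app a t u)    = app a (sub σ t) (sub σ u)

single : Tm → ℕ → Tm
single u zero    = u
single u (suc n) = var n

_[_] : Tm → Tm → Tm
t [ u ] = sub (single u) t

infixl 5 _▸_∶_
data Ctx : Set where
  ε     : Ctx
  _▸_∶_ : Ctx → Ann → Tm → Ctx

_⊕ : Ctx → Ctx
ε ⊕           = ε
(Γ ▸ a ∶ U) ⊕ = (Γ ⊕) ▸ rel ∶ U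

data _∋_∶[_]_ : Ctx → ℕ → Ann → Tm → Set where
  here  : ∀ {Γ a U} → (Γ ▸ a ∶ U) ∋ zero ∶[ a ] wk U
  there : ∀ {Γ a b U V x} → Γ ∋ x ∶[ b ] U → (Γ ▸ a ∶ V) ∋ suc x ∶[ b ] wk U

infix 4 ⊢_ _⊢_∶_ _⊢_≡_∶_ _⊢_∈[_]_ _⊢_≡_∈[_]_

data ⊢_ : Ctx → Set
data _⊢_∶_ : Ctx → Tm → Tm → Set
data _⊢_≡_∶_ : Ctx → Tm → Tm → Tm → Set
data _⊢_∈[_]_ : Ctx → Tm → Ann → Tm → Set
data _⊢_≡_∈[_]_ : Ctx → Tm → Tm → Ann → Tm → Set

data ⊢_ where
  ctx-ε : ⊢ ε
  ctx-▸ : ∀ {Γ a T k} → ⊢ Γ → Γ ⊢ T ∶ sort k → ⊢ (Γ ▸ a ∶ T)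

data _⊢_∈[_]_ where
  ann-rel : ∀ {Γ u U} → Γ ⊢ u ∶ U → Γ ⊢ u ∈[ rel ] U
  ann-irr : ∀ {Γ u U} → (Γ ⊕) ⊢ u ∶ U → Γ ⊢ u ∈[ irr ] U

data _⊢_≡_∈[_]_ where
  eqann-rel : ∀ {Γ u u' U} → Γ ⊢ u ≡ u' ∶ U → Γ ⊢ u ≡ u' ∈[ rel ] U
  eqann-irr : ∀ {Γ u u' U} → (Γ ⊕) ⊢ u ∶ U → (Γ ⊕) ⊢ u' ∶ U → Γ ⊢ u ≡ u' ∈[ irr ] U

data _⊢_∶_ where
  ty-sort : ∀ {Γ i} → ⊢ Γ → Γ ⊢ sort i ∶ sort (suc i)
  ty-pi   : ∀ {Γ a i j U T} → Γ ⊢ U ∶ sort i → (Γ ▸ a ∶ U) ⊢ T ∶ sort j →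
            Γ ⊢ pi a i j U T ∶ sort (i ⊔ j)
  ty-var  : ∀ {Γ x U} → ⊢ Γ → Γ ∋ x ∶[ rel ] U → Γ ⊢ var x ∶ U
  ty-lam  : ∀ {Γ a i j k U T t} → (Γ ▸ a ∶ U) ⊢ t ∶ T →
            Γ ⊢ pi a i j U T ∶ sort k → Γ ⊢ lam a U t ∶ pi a i j U T
  ty-app  : ∀ {Γ a i j U T t u} → Γ ⊢ t ∶ pi a i j U T → Γ ⊢ u ∈[ a ] U →
            Γ ⊢ app a t u ∶ T [ u ]
  ty-conv : ∀ {Γ t T T' k} → Γ ⊢ t ∶ T → Γ ⊢ T ≡ T' ∶ sort k → Γ ⊢ t ∶ T'

data _⊢_≡_∶_ where
  eq-β     : ∀ {Γ a U T t u} → (Γ ▸ a ∶ U) ⊢ t ∶ T → Γ ⊢ u ∈[ a ] U →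
             Γ ⊢ app a (lam a U t) u ≡ t [ u ] ∶ T [ u ]
  eq-η     : ∀ {Γ a i j U T t} → Γ ⊢ t ∶ pi a i j U T →
             Γ ⊢ t ≡ lam a U (app a (wk t) (var zero)) ∶ pi a i j U T
  eq-refl  : ∀ {Γ t T} → Γ ⊢ t ∶ T → Γ ⊢ t ≡ t ∶ T
  eq-sym   : ∀ {Γ t t' T} → Γ ⊢ t ≡ t' ∶ T → Γ ⊢ t' ≡ t ∶ T
  eq-trans : ∀ {Γ t t' t'' T} → Γ ⊢ t ≡ t' ∶ T → Γ ⊢ t' ≡ t'' ∶ T → Γ ⊢ t ≡ t'' ∶ T
  eq-pi    : ∀ {Γ a i j U U' T T'} → Γ ⊢ U ≡ U' ∶ sort i →
             (Γ ▸ a ∶ U) ⊢ T ≡ T' ∶ sort j →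
             Γ ⊢ pi a i j U T ≡ pi a i j U' T' ∶ sort (i ⊔ j)
  eq-lam   : ∀ {Γ a i j U U' T t t'} → Γ ⊢ U ≡ U' ∶ sort i →
             (Γ ▸ a ∶ U) ⊢ T ∶ sort j → (Γ ▸ a ∶ U) ⊢ t ≡ t' ∶ T →
             Γ ⊢ lam a U t ≡ lam a U' t' ∶ pi a i j U T
  eq-app   : ∀ {Γ a i j U T t t' u u'} → Γ ⊢ t ≡ t' ∶ pi a i j U T →
             Γ ⊢ u ≡ u' ∈[ a ] U → Γ ⊢ app a t u ≡ app a t' u' ∶ T [ u ]
  eq-conv  : ∀ {Γ t t' T T' k} → Γ ⊢ t ≡ t' ∶ T → Γ ⊢ T ≡ T' ∶ sort k →
             Γ ⊢ t ≡ t' ∶ T'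

{-# OPTIONS --safe #-}

-- Uniqueness of types needs injectivity of function types and of sorts for the typed equality
-- with η.  Both are read off a Kripke logical relation: it relates two types only if their weak
-- head normal forms have the same shape and related components, and it relates all judgementally
-- equal types.  Worlds are renamings that may resurrect variables, and an irrelevant argument
-- ranges over pairs of terms that are separately reducible in the resurrected context, so
-- semantically the codomain cannot depend on it.  Equality of types is indexed by a sort and
-- transitivity only composes at a fixed sort, so one first shows that the sort of a type is
-- unique, by comparing weak head normal forms; this needs uniqueness of types only for neutral
-- terms, which avoids the case of λ, the one that itself relies on uniqueness of sorts.

module Submission where

open import Defs
open import Data.Empty using (⊥; ⊥-elim)
open import Data.Nat using (ℕ; zero; suc; _⊔_; _<′_; _≤′_; ≤′-refl; ≤′-step)
open import Data.Nat.Properties using (≤′-trans; ≤⇒≤′; m≤m⊔n; m≤n⊔m)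
open import Data.Product using (Σ; ∃; _×_; _,_; proj₁; proj₂)
open import Data.Unit using (⊤; tt)
open import Function using (_∘_)
open import Relation.Binary.PropositionalEquality
  using (refl; sym; trans; cong; cong₂; subst) renaming (_≡_ to _≐_)

-- Renaming and substitution

cons : Tm → (ℕ → Tm) → ℕ → Tm
cons u σ zero    = u
cons u σ (suc n) = σ n

liftRen-ext : ∀ {ρ ρ'} → (∀ x → ρ x ≐ ρ' x) → ∀ x → liftRen ρ x ≐ liftRen ρ' x
liftRen-ext e zero    = refl
liftRen-ext e (suc x) = cong suc (e x)

ren-ext : ∀ {ρ ρ'} → (∀ x → ρ x ≐ ρ' x) → ∀ t → ren ρ t ≐ ren ρ' t
ren-ext e (sort k)       = refl
ren-ext e (pi a i j U T) = cong₂ (pi a i j) (ren-ext e U) (ren-ext (liftRen-ext e) T)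
ren-ext e (var x)        = cong var (e x)
ren-ext e (lam a U t)    = cong₂ (lam a) (ren-ext e U) (ren-ext (liftRen-ext e) t)
ren-ext e (app a t u)    = cong₂ (app a) (ren-ext e t) (ren-ext e u)

liftSub-ext : ∀ {σ σ'} → (∀ x → σ x ≐ σ' x) → ∀ x → liftSub σ x ≐ liftSub σ' x
liftSub-ext e zero    = refl
liftSub-ext e (suc x) = cong wk (e x)

sub-ext : ∀ {σ σ'} → (∀ x → σ x ≐ σ' x) → ∀ t → sub σ t ≐ sub σ' t
sub-ext e (sort k)       = refl
sub-ext e (pi a i j U T) = cong₂ (pi a i j) (sub-ext e U) (sub-ext (liftSub-ext e) T)
sub-ext e (var x)        = e x
sub-ext e (lam a U t)    = cong₂ (lam a) (sub-ext e U) (sub-ext (liftSub-ext e) t)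
sub-ext e (app a t u)    = cong₂ (app a) (sub-ext e t) (sub-ext e u)

sub-ren-lift : ∀ {σ ρ} x → liftSub σ (liftRen ρ x) ≐ liftSub (σ ∘ ρ) x
sub-ren-lift zero    = refl
sub-ren-lift (suc x) = refl

sub-ren : ∀ {σ ρ} t → sub σ (ren ρ t) ≐ sub (σ ∘ ρ) t
sub-ren (sort k)       = refl
sub-ren (pi a i j U T) = cong₂ (pi a i j) (sub-ren U) (trans (sub-ren T) (sub-ext sub-ren-lift T))
sub-ren (var x)        = refl
sub-ren (lam a U t)    = cong₂ (lam a) (sub-ren U) (trans (sub-ren t) (sub-ext sub-ren-lift t))
sub-ren (app a t u)    = cong₂ (app a) (sub-ren t) (sub-ren u)

liftSub-var : ∀ x → liftSub var x ≐ var x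
liftSub-var zero    = refl
liftSub-var (suc x) = refl

sub-var : ∀ t → sub var t ≐ t
sub-var (sort k)       = refl
sub-var (pi a i j U T) = cong₂ (pi a i j) (sub-var U) (trans (sub-ext liftSub-var T) (sub-var T))
sub-var (var x)        = refl
sub-var (lam a U t)    = cong₂ (lam a) (sub-var U) (trans (sub-ext liftSub-var t) (sub-var t))
sub-var (app a t u)    = cong₂ (app a) (sub-var t) (sub-var u)

ren-as-sub : ∀ {ρ} t → ren ρ t ≐ sub (var ∘ ρ) t
ren-as-sub {ρ} t = trans (sym (sub-var (ren ρ t))) (sub-ren t)

ren-ren : ∀ {ρ ρ'} t → ren ρ' (ren ρ t) ≐ ren (ρ' ∘ ρ) t
ren-ren {ρ} t = trans (ren-as-sub (ren ρ t)) (trans (sub-ren t) (sym (ren-as-sub t)))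

ren-id : ∀ t → ren (λ x → x) t ≐ t
ren-id t = trans (ren-as-sub t) (sub-var t)

wk-comm : ∀ {ρ} t → wk (ren ρ t) ≐ ren (liftRen ρ) (wk t)
wk-comm t = trans (ren-ren t) (sym (ren-ren t))

ren-sub : ∀ {σ ρ} t → ren ρ (sub σ t) ≐ sub (ren ρ ∘ σ) t
ren-sub-lift : ∀ {σ ρ} x → ren (liftRen ρ) (liftSub σ x) ≐ liftSub (ren ρ ∘ σ) x
ren-sub-lift zero    = refl
ren-sub-lift {σ} (suc x) = sym (wk-comm (σ x))
ren-sub (sort k)       = refl
ren-sub (pi a i j U T) = cong₂ (pi a i j) (ren-sub U) (trans (ren-sub T) (sub-ext ren-sub-lift T))
ren-sub (var x)        = refl
ren-sub (lam a U t)    = cong₂ (lam a) (ren-sub U) (trans (ren-sub t) (sub-ext ren-sub-lift t))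
ren-sub (app a t u)    = cong₂ (app a) (ren-sub t) (ren-sub u)

wk-sub : ∀ {σ} t → sub (liftSub σ) (wk t) ≐ wk (sub σ t)
wk-sub t = trans (sub-ren t) (sym (ren-sub t))

sub-sub : ∀ {σ τ} t → sub τ (sub σ t) ≐ sub (sub τ ∘ σ) t
sub-sub-lift : ∀ {σ τ} x → sub (liftSub τ) (liftSub σ x) ≐ liftSub (sub τ ∘ σ) x
sub-sub-lift zero    = refl
sub-sub-lift {σ} (suc x) = wk-sub (σ x)
sub-sub (sort k)       = refl
sub-sub (pi a i j U T) = cong₂ (pi a i j) (sub-sub U) (trans (sub-sub T) (sub-ext sub-sub-lift T))
sub-sub (var x)        = refl
sub-sub (lam a U t)    = cong₂ (lam a) (sub-sub U) (trans (sub-sub t) (sub-ext sub-sub-lift t))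
sub-sub (app a t u)    = cong₂ (app a) (sub-sub t) (sub-sub u)

wk-[] : ∀ {u} t → wk t [ u ] ≐ t
wk-[] t = trans (sub-ren t) (sub-var t)

ren-lift-[] : ∀ {ρ u} T → ren (liftRen ρ) T [ u ] ≐ sub (cons u (var ∘ ρ)) T
ren-lift-[] {ρ} {u} T = trans (sub-ren T) (sub-ext h T)
  where h : ∀ x → single u (liftRen ρ x) ≐ cons u (var ∘ ρ) x
        h zero = refl
        h (suc x) = refl

sub-lift-[] : ∀ {σ u} T → sub (liftSub σ) T [ u ] ≐ sub (cons u σ) T
sub-lift-[] {σ} {u} T = trans (sub-sub T) (sub-ext h T)
  where h : ∀ x → sub (single u) (liftSub σ x) ≐ cons u σ x
        h zero = refl
        h (suc x) = wk-[] (σ x)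

-- The logical relation instantiates a codomain after renaming it, as on the left; validity supplies
-- it under an extended substitution, as on the right.
ren-sub-lift-[] : ∀ {σ ρ u} T → ren (liftRen ρ) (sub (liftSub σ) T) [ u ] ≐ sub (cons u (ren ρ ∘ σ)) T
ren-sub-lift-[] T = trans (cong _[ _ ] (trans (ren-sub T) (sub-ext ren-sub-lift T))) (sub-lift-[] T)

sub-[] : ∀ {σ u} T → sub σ (T [ u ]) ≐ sub (cons (sub σ u) σ) T
sub-[] {σ} {u} T = trans (sub-sub T) (sub-ext h T)
  where h : ∀ x → sub σ (single u x) ≐ cons (sub σ u) σ x
        h zero = refl
        h (suc x) = refl

ren-[] : ∀ {ρ u} T → ren ρ (T [ u ]) ≐ ren (liftRen ρ) T [ ren ρ u ]
ren-[] {ρ} {u} T = trans (ren-sub T) (trans (sub-ext h T) (sym (ren-lift-[] T)))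
  where h : ∀ x → ren ρ (single u x) ≐ cons (ren ρ u) (var ∘ ρ) x
        h zero = refl
        h (suc x) = refl

ren-ren-lift-[] : ∀ {ρ ρ' u} T → ren (liftRen ρ') (ren (liftRen ρ) T) [ u ] ≐ ren (liftRen (ρ' ∘ ρ)) T [ u ]
ren-ren-lift-[] {ρ} {ρ'} {u} T = cong _[ u ] (trans (ren-ren T) (ren-ext h T))
  where h : ∀ x → liftRen ρ' (liftRen ρ x) ≐ liftRen (ρ' ∘ ρ) x
        h zero = refl
        h (suc x) = refl

ren-id-lift-[] : ∀ {u} T → ren (liftRen (λ x → x)) T [ u ] ≐ T [ u ]
ren-id-lift-[] {u} T = cong _[ u ] (trans (ren-ext h T) (ren-id T))
  where h : ∀ x → liftRen (λ x → x) x ≐ x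
        h zero = refl
        h (suc x) = refl

ren-suc-lift-[] : ∀ T → ren (liftRen suc) T [ var zero ] ≐ T
ren-suc-lift-[] T = trans (ren-lift-[] T) (trans (sub-ext h T) (sub-var T))
  where h : ∀ x → cons (var zero) (var ∘ suc) x ≐ var x
        h zero = refl
        h (suc x) = refl

-- Renaming of derivations

data _⊑_ : Ann → Ann → Set where
  ⊑-refl : ∀ {a} → a ⊑ a
  rel⊑   : ∀ {a} → rel ⊑ a

⊕-idem : ∀ Γ → (Γ ⊕) ⊕ ≐ Γ ⊕
⊕-idem ε           = refl
⊕-idem (Γ ▸ a ∶ U) = cong (_▸ rel ∶ U) (⊕-idem Γ)

∋-⊕ : ∀ {Γ x a U} → Γ ∋ x ∶[ a ] U → (Γ ⊕) ∋ x ∶[ rel ] U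
∋-⊕ here      = here
∋-⊕ (there h) = there (∋-⊕ h)

∋-⊕⁻¹ : ∀ {Γ x a U} → (Γ ⊕) ∋ x ∶[ a ] U → (a ≐ rel) × (∃ λ b → Γ ∋ x ∶[ b ] U)
∋-⊕⁻¹ {Γ ▸ a ∶ U} here = refl , a , here
∋-⊕⁻¹ {Γ ▸ a ∶ U} (there h) with ∋-⊕⁻¹ h
... | refl , b , h' = refl , b , there h'

castT : ∀ {Γ t T T'} → T ≐ T' → Γ ⊢ t ∶ T → Γ ⊢ t ∶ T'
castT refl d = d

castE : ∀ {Γ t u u' T T'} → u ≐ u' → T ≐ T' → Γ ⊢ t ≡ u ∶ T → Γ ⊢ t ≡ u' ∶ T'
castE refl refl d = d

cast∋ : ∀ {Γ x a U U'} → U ≐ U' → Γ ∋ x ∶[ a ] U → Γ ∋ x ∶[ a ] U'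
cast∋ refl h = h

-- A variable may become relevant but not irrelevant, so the identity is a renaming from Γ to Γ ⊕.
record Wk (Δ : Ctx) (ρ : ℕ → ℕ) (Γ : Ctx) : Set where
  field
    wf   : ⊢ Δ
    wf-⊕ : ⊢ (Δ ⊕)
    map  : ∀ {x a U} → Γ ∋ x ∶[ a ] U → ∃ λ b → b ⊑ a × Δ ∋ ρ x ∶[ b ] ren ρ U
open Wk

Wk-⊕ : ∀ {Δ ρ Γ} → Wk Δ ρ Γ → Wk (Δ ⊕) ρ Γ
Wk-⊕ {Δ} w .wf   = w .wf-⊕
Wk-⊕ {Δ} w .wf-⊕ = subst ⊢_ (sym (⊕-idem Δ)) (w .wf-⊕)
Wk-⊕ {Δ} w .map h = rel , rel⊑ , ∋-⊕ (proj₂ (proj₂ (w .map h)))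

-- Every variable of `Γ ⊕` is relevant and comes from one of `Γ`, whose image is relevant in `Δ ⊕`.
-- Irrelevant arguments are renamed along this.
Wk-⊕⊕ : ∀ {Δ ρ Γ} → Wk Δ ρ Γ → Wk (Δ ⊕) ρ (Γ ⊕)
Wk-⊕⊕ w .wf   = Wk-⊕ w .wf
Wk-⊕⊕ w .wf-⊕ = Wk-⊕ w .wf-⊕
Wk-⊕⊕ w .map h with ∋-⊕⁻¹ h
... | refl , b , h' = rel , ⊑-refl , ∋-⊕ (proj₂ (proj₂ (w .map h')))

Wk-ext : ∀ {Δ ρ Γ a U k} → Wk Δ ρ Γ → Δ ⊢ ren ρ U ∶ sort k → (Δ ⊕) ⊢ ren ρ U ∶ sort k →
           Wk (Δ ▸ a ∶ ren ρ U) (liftRen ρ) (Γ ▸ a ∶ U)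
Wk-ext w d d⊕ .wf   = ctx-▸ (w .wf) d
Wk-ext w d d⊕ .wf-⊕ = ctx-▸ (w .wf-⊕) d⊕
Wk-ext {a = a} {U} w d d⊕ .map here = a , ⊑-refl , cast∋ (wk-comm U) here
Wk-ext w d d⊕ .map (there {U = V} h) with w .map h
... | b , le , h' = b , le , cast∋ (wk-comm V) (there h')

Renamable : Ctx → Tm → Tm → Set
Renamable Γ t T = ∀ {Δ ρ} → Wk Δ ρ Γ → Δ ⊢ ren ρ t ∶ ren ρ T

-- Carried along by ren-typing below: the rules β, eq-pi and eq-lam extend the context without
-- giving a derivation for the new binding.
RenamableCtx : Ctx → Set
RenamableCtx ε           = ⊤
RenamableCtx (Γ ▸ a ∶ U) = RenamableCtx Γ × ∃ λ k → Renamable Γ U (sort k)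

pi-dom : ∀ {Γ a i j U T S} → Γ ⊢ pi a i j U T ∶ S → Γ ⊢ U ∶ sort i
pi-dom (ty-pi d e)   = d
pi-dom (ty-conv d e) = pi-dom d

pi-cod : ∀ {Γ a i j U T S} → Γ ⊢ pi a i j U T ∶ S → (Γ ▸ a ∶ U) ⊢ T ∶ sort j
pi-cod (ty-pi d e)   = e
pi-cod (ty-conv d e) = pi-cod d

-- `Renamable` quantifies over all targets, so it also types the new binding in `Δ ⊕`, as `Wk-ext`
-- demands.
Wk-lift-renamable : ∀ {Δ ρ Γ a U k} → Wk Δ ρ Γ → Renamable Γ U (sort k) →
           Wk (Δ ▸ a ∶ ren ρ U) (liftRen ρ) (Γ ▸ a ∶ U)
Wk-lift-renamable w r = Wk-ext w (r w) (r (Wk-⊕ w))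

ren-ctx    : ∀ {Γ} → ⊢ Γ → RenamableCtx Γ
ren-typing : ∀ {Γ t T} → Γ ⊢ t ∶ T → RenamableCtx Γ × Renamable Γ t T
ren-eq     : ∀ {Γ t t' T} → Γ ⊢ t ≡ t' ∶ T →
             RenamableCtx Γ × (∀ {Δ ρ} → Wk Δ ρ Γ → Δ ⊢ ren ρ t ≡ ren ρ t' ∶ ren ρ T)
ren-arg    : ∀ {Γ a u U} → Γ ⊢ u ∈[ a ] U → ∀ {Δ ρ} → Wk Δ ρ Γ → Δ ⊢ ren ρ u ∈[ a ] ren ρ U
ren-eqarg  : ∀ {Γ a u u' U} → Γ ⊢ u ≡ u' ∈[ a ] U →
             ∀ {Δ ρ} → Wk Δ ρ Γ → Δ ⊢ ren ρ u ≡ ren ρ u' ∈[ a ] ren ρ U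

ren-ctx ctx-ε       = tt
ren-ctx (ctx-▸ c d) = ren-ctx c , _ , λ w → proj₂ (ren-typing d) w

ren-typing (ty-sort c) = ren-ctx c , λ w → ty-sort (w .wf)
ren-typing (ty-pi d e) with ren-typing d
... | q , r = q , λ w → ty-pi (r w) (proj₂ (ren-typing e) (Wk-lift-renamable w r))
ren-typing (ty-var c h) = ren-ctx c , v
  where v : ∀ {Δ ρ} → Wk Δ ρ _ → Δ ⊢ var (ρ _) ∶ ren ρ _
        v w with w .map h
        ... | _ , ⊑-refl , h' = ty-var (w .wf) h'
        ... | _ , rel⊑   , h' = ty-var (w .wf) h'
ren-typing (ty-lam d p) with ren-typing d | ren-typing p
... | (_ , _ , rU) , rt | q , rp =
  q , λ w → ty-lam (rt (Wk-lift-renamable w rU)) (rp w)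
ren-typing (ty-app {T = T} d e) with ren-typing d
... | q , r = q , λ w → castT (sym (ren-[] T)) (ty-app (r w) (ren-arg e w))
ren-typing (ty-conv d e) with ren-typing d
... | q , r = q , λ w → ty-conv (r w) (proj₂ (ren-eq e) w)

ren-eq (eq-β {T = T} {t = t} d e) with ren-typing d
... | (q , _ , rU) , r = q , λ w →
  castE (sym (ren-[] t)) (sym (ren-[] T)) (eq-β (r (Wk-lift-renamable w rU)) (ren-arg e w))
ren-eq (eq-η {t = t} d) with ren-typing d
... | q , r = q , λ w →
  castE (cong (λ x → lam _ _ (app _ x _)) (wk-comm t)) refl (eq-η (r w))
ren-eq (eq-refl d) with ren-typing d
... | q , r = q , λ w → eq-refl (r w)
ren-eq (eq-sym d) with ren-eq d
... | q , r = q , λ w → eq-sym (r w)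
ren-eq (eq-trans d e) with ren-eq d
... | q , r = q , λ w → eq-trans (r w) (proj₂ (ren-eq e) w)
ren-eq (eq-pi d e) with ren-eq d | ren-eq e
... | q , r | (_ , _ , rU) , r' = q , λ w → eq-pi (r w) (r' (Wk-lift-renamable w rU))
ren-eq (eq-lam d p e) with ren-eq d | ren-typing p | ren-eq e
... | q , r | (_ , _ , rU) , rT | _ , r' =
  q , λ w → eq-lam (r w) (rT (Wk-lift-renamable w rU)) (r' (Wk-lift-renamable w rU))
ren-eq (eq-app {T = T} d e) with ren-eq d
... | q , r = q , λ w → castE refl (sym (ren-[] T)) (eq-app (r w) (ren-eqarg e w))
ren-eq (eq-conv d e) with ren-eq d
... | q , r = q , λ w → eq-conv (r w) (proj₂ (ren-eq e) w)

ren-arg (ann-rel d) w = ann-rel (proj₂ (ren-typing d) w)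
ren-arg (ann-irr d) w = ann-irr (proj₂ (ren-typing d) (Wk-⊕⊕ w))

ren-eqarg (eqann-rel d)   w = eqann-rel (proj₂ (ren-eq d) w)
ren-eqarg (eqann-irr d e) w =
  eqann-irr (proj₂ (ren-typing d) (Wk-⊕⊕ w)) (proj₂ (ren-typing e) (Wk-⊕⊕ w))

renT : ∀ {Γ Δ ρ t T} → Wk Δ ρ Γ → Γ ⊢ t ∶ T → Δ ⊢ ren ρ t ∶ ren ρ T
renT w d = proj₂ (ren-typing d) w

Wk-lift : ∀ {Δ ρ Γ a U k} → Wk Δ ρ Γ → Γ ⊢ U ∶ sort k →
          Wk (Δ ▸ a ∶ ren ρ U) (liftRen ρ) (Γ ▸ a ∶ U)
Wk-lift w d = Wk-lift-renamable w (proj₂ (ren-typing d))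

-- The identity renames `Γ` into `Γ ⊕`, so `renT` transports each binding. Since this relies on
-- renaming, `Wk` stores `wf-⊕` instead of deriving it.
ctx-⊕ : ∀ {Γ} → ⊢ Γ → ⊢ (Γ ⊕)
ctx-⊕ ctx-ε = ctx-ε
ctx-⊕ (ctx-▸ {Γ} {T = T} c d) = ctx-▸ (ctx-⊕ c) (subst (λ V → _ ⊢ V ∶ _) (ren-id T) (renT w d))
  where
  w : Wk (Γ ⊕) (λ x → x) Γ
  w .wf   = ctx-⊕ c
  w .wf-⊕ = subst ⊢_ (sym (⊕-idem Γ)) (ctx-⊕ c)
  w .map {U = U} h = rel , rel⊑ , cast∋ (sym (ren-id U)) (∋-⊕ h)

Wk-id : ∀ {Γ} → ⊢ Γ → Wk Γ (λ x → x) Γ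
Wk-id c .wf   = c
Wk-id c .wf-⊕ = ctx-⊕ c
Wk-id c .map {a = a} {U} h = a , ⊑-refl , cast∋ (sym (ren-id U)) h

Wk-suc : ∀ {Γ a U} → ⊢ (Γ ▸ a ∶ U) → Wk (Γ ▸ a ∶ U) suc Γ
Wk-suc c .wf   = c
Wk-suc c .wf-⊕ = ctx-⊕ c
Wk-suc c .map h = _ , ⊑-refl , there h

Wk-∘ : ∀ {Γ Δ Θ ρ ρ'} → Wk Δ ρ Γ → Wk Θ ρ' Δ → Wk Θ (ρ' ∘ ρ) Γ
Wk-∘ w w' .wf   = w' .wf
Wk-∘ w w' .wf-⊕ = w' .wf-⊕
Wk-∘ w w' .map {U = U} h with w .map h
... | b , le , h' with w' .map h'
... | c , le' , h'' = c , ⊑-trans le' le , cast∋ (ren-ren U) h''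
  where ⊑-trans : ∀ {a b c} → a ⊑ b → b ⊑ c → a ⊑ c
        ⊑-trans ⊑-refl q = q
        ⊑-trans rel⊑   q = rel⊑

res : Ann → Ctx → Ctx
res rel Γ = Γ
res irr Γ = Γ ⊕

Wk-res : ∀ a {Γ Δ ρ} → Wk Δ ρ Γ → Wk (res a Δ) ρ Γ
Wk-res rel w = w
Wk-res irr w = Wk-⊕ w

Wk-res-res : ∀ a {Γ Δ ρ} → Wk Δ ρ Γ → Wk (res a Δ) ρ (res a Γ)
Wk-res-res rel w = w
Wk-res-res irr w = Wk-⊕⊕ w

wfT : ∀ {Γ t T} → Γ ⊢ t ∶ T → ⊢ Γ
wfT (ty-sort c)   = c
wfT (ty-pi d e)   = wfT d
wfT (ty-var c h)  = c
wfT (ty-lam d e)  = wfT e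
wfT (ty-app d e)  = wfT d
wfT (ty-conv d e) = wfT d

-- Weak head reduction and the logical relation

infix 4 _⊢_≈_∶_ _⊢_≈_∈[_]_ _⊢_↘_∶_ _⇒_ _⇒*_

-- Typing of both sides is carried along because it follows from the equality only by the
-- fundamental theorem, in `presup`.
record _⊢_≈_∶_ (Γ : Ctx) (t t' T : Tm) : Set where
  constructor mk≈
  field
    lhs : Γ ⊢ t ∶ T
    rhs : Γ ⊢ t' ∶ T
    eq  : Γ ⊢ t ≡ t' ∶ T
open _⊢_≈_∶_

record _⊢_≈_∈[_]_ (Γ : Ctx) (t t' : Tm) (a : Ann) (T : Tm) : Set where
  constructor mk≈ₐ
  field
    lhsₐ : Γ ⊢ t ∈[ a ] T
    rhsₐ : Γ ⊢ t' ∈[ a ] T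
    eqₐ  : Γ ⊢ t ≡ t' ∈[ a ] T
open _⊢_≈_∈[_]_

≈-refl : ∀ {Γ t T} → Γ ⊢ t ∶ T → Γ ⊢ t ≈ t ∶ T
≈-refl d = mk≈ d d (eq-refl d)

≈-sym : ∀ {Γ t t' T} → Γ ⊢ t ≈ t' ∶ T → Γ ⊢ t' ≈ t ∶ T
≈-sym (mk≈ d d' e) = mk≈ d' d (eq-sym e)

≈-trans : ∀ {Γ t t' t'' T} → Γ ⊢ t ≈ t' ∶ T → Γ ⊢ t' ≈ t'' ∶ T → Γ ⊢ t ≈ t'' ∶ T
≈-trans (mk≈ d _ e) (mk≈ _ d' e') = mk≈ d d' (eq-trans e e')

≈-conv : ∀ {Γ t t' T T' k} → Γ ⊢ t ≈ t' ∶ T → Γ ⊢ T ≈ T' ∶ sort k → Γ ⊢ t ≈ t' ∶ T'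
≈-conv (mk≈ d d' e) c = mk≈ (ty-conv d (c .eq)) (ty-conv d' (c .eq)) (eq-conv e (c .eq))

≈-ren : ∀ {Γ Δ ρ t t' T} → Wk Δ ρ Γ → Γ ⊢ t ≈ t' ∶ T → Δ ⊢ ren ρ t ≈ ren ρ t' ∶ ren ρ T
≈-ren w (mk≈ d d' e) = mk≈ (renT w d) (renT w d') (proj₂ (ren-eq e) w)

-- The second application naturally has type `T [ u' ]`; the last premise converts it to `T [ u ]`.
app-≈ : ∀ {Γ a i j k U T t t' u u'} → Γ ⊢ t ≈ t' ∶ pi a i j U T → Γ ⊢ u ≈ u' ∈[ a ] U →
        Γ ⊢ T [ u ] ≈ T [ u' ] ∶ sort k → Γ ⊢ app a t u ≈ app a t' u' ∶ T [ u ]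
app-≈ (mk≈ d d' e) (mk≈ₐ f f' g) c =
  mk≈ (ty-app d f) (ty-conv (ty-app d' f') (eq-sym (c .eq))) (eq-app e g)

data _⇒_ : Tm → Tm → Set where
  ⇒-β   : ∀ {a U t u} → app a (lam a U t) u ⇒ t [ u ]
  ⇒-app : ∀ {a t t' u} → t ⇒ t' → app a t u ⇒ app a t' u

data _⇒*_ : Tm → Tm → Set where
  ⇒*-refl : ∀ {t} → t ⇒* t
  ⇒*-step : ∀ {t t' t''} → t ⇒ t' → t' ⇒* t'' → t ⇒* t''

data Ne : Tm → Set where
  ne-var : ∀ {x} → Ne (var x)
  ne-app : ∀ {a t u} → Ne t → Ne (app a t u)

-- There is no case for `lam` because only types are brought to this form.
data Whnf : Tm → Set where
  w-sort : ∀ {i} → Whnf (sort i)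
  w-pi   : ∀ {a i j U T} → Whnf (pi a i j U T)
  w-ne   : ∀ {t} → Ne t → Whnf t

⇒-det : ∀ {t u v} → t ⇒ u → t ⇒ v → u ≐ v
⇒-det ⇒-β       ⇒-β        = refl
⇒-det (⇒-app r) (⇒-app r') = cong (λ x → app _ x _) (⇒-det r r')

ne-⇏ : ∀ {t u} → Ne t → t ⇒ u → ⊥
ne-⇏ (ne-app ()) ⇒-β
ne-⇏ (ne-app n) (⇒-app r) = ne-⇏ n r

whnf-⇏ : ∀ {t u} → Whnf t → t ⇒ u → ⊥
whnf-⇏ (w-ne n) r = ne-⇏ n r

whnf-det : ∀ {t u v} → Whnf u → Whnf v → t ⇒* u → t ⇒* v → u ≐ v
whnf-det wu wv ⇒*-refl ⇒*-refl = refl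
whnf-det wu wv ⇒*-refl (⇒*-step r _) = ⊥-elim (whnf-⇏ wu r)
whnf-det wu wv (⇒*-step r _) ⇒*-refl = ⊥-elim (whnf-⇏ wv r)
whnf-det wu wv (⇒*-step r rs) (⇒*-step r' rs') with ⇒-det r r'
... | refl = whnf-det wu wv rs rs'

ne≢sort : ∀ {t j} → Ne t → t ≐ sort j → ⊥
ne≢sort ne-var ()
ne≢sort (ne-app n) ()

ne≢pi : ∀ {t a i j U T} → Ne t → t ≐ pi a i j U T → ⊥
ne≢pi ne-var ()
ne≢pi (ne-app n) ()

⇒-ren : ∀ {ρ t u} → t ⇒ u → ren ρ t ⇒ ren ρ u
⇒-ren {ρ} (⇒-β {t = t}) = subst (app _ _ _ ⇒_) (sym (ren-[] t)) ⇒-β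
⇒-ren (⇒-app r) = ⇒-app (⇒-ren r)

⇒*-ren : ∀ {ρ t u} → t ⇒* u → ren ρ t ⇒* ren ρ u
⇒*-ren ⇒*-refl        = ⇒*-refl
⇒*-ren (⇒*-step r rs) = ⇒*-step (⇒-ren r) (⇒*-ren rs)

⇒*-app : ∀ {a t t' u} → t ⇒* t' → app a t u ⇒* app a t' u
⇒*-app ⇒*-refl        = ⇒*-refl
⇒*-app (⇒*-step r rs) = ⇒*-step (⇒-app r) (⇒*-app rs)

⇒*-trans : ∀ {t u v} → t ⇒* u → u ⇒* v → t ⇒* v
⇒*-trans ⇒*-refl        q = q
⇒*-trans (⇒*-step r rs) q = ⇒*-step r (⇒*-trans rs q)

ne-ren : ∀ {ρ t} → Ne t → Ne (ren ρ t)
ne-ren ne-var     = ne-var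
ne-ren (ne-app n) = ne-app (ne-ren n)

-- Reduction is untyped, so the judgemental equality with the reduct accompanies it.
record _⊢_↘_∶_ (Γ : Ctx) (A M : Tm) (k : ℕ) : Set where
  constructor mk↘
  field
    red  : A ⇒* M
    conv : Γ ⊢ A ≈ M ∶ sort k
open _⊢_↘_∶_

↘-ren : ∀ {Γ Δ ρ A M k} → Wk Δ ρ Γ → Γ ⊢ A ↘ M ∶ k → Δ ⊢ ren ρ A ↘ ren ρ M ∶ k
↘-ren w (mk↘ r e) = mk↘ (⇒*-ren r) (≈-ren w e)

↘-exp : ∀ {Γ A A' M k} → A ⇒* A' → Γ ⊢ A ≈ A' ∶ sort k → Γ ⊢ A' ↘ M ∶ k → Γ ⊢ A ↘ M ∶ k
↘-exp r e (mk↘ r' e') = mk↘ (⇒*-trans r r') (≈-trans e e')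

-- Kripke logical relation on types at Set_k and, by recursion on its derivations, on terms.
-- N bounds the universes that may occur and rec interprets them; an irrelevant argument is a
-- pair of unrelated terms, each reducible over the resurrected context.
data LR′ (N : ℕ) (rec : ∀ j → j <′ N → Ctx → Tm → Tm → Set) (Γ : Ctx) (k : ℕ) (A B : Tm) : Set
El  : ∀ {N rec Γ k A B} → LR′ N rec Γ k A B → Tm → Tm → Set
Elₐ : ∀ a {N rec Γ k A B} → LR′ N rec (res a Γ) k A B → Tm → Tm → Set

data LR′ N rec Γ k A B where
  sortᵣ : ∀ {j} (p : j <′ N) → Γ ⊢ A ↘ sort j ∶ k → Γ ⊢ B ↘ sort j ∶ k → LR′ N rec Γ k A B
  neᵣ   : ∀ {M M'} → Ne M → Ne M' → Γ ⊢ A ↘ M ∶ k → Γ ⊢ B ↘ M' ∶ k → Γ ⊢ M ≈ M' ∶ sort k →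
          LR′ N rec Γ k A B
  piᵣ   : ∀ {a i j U U' T T'} →
          Γ ⊢ A ↘ pi a i j U T ∶ k → Γ ⊢ B ↘ pi a i j U' T' ∶ k →
          Γ ⊢ pi a i j U T ≈ pi a i j U' T' ∶ sort k →
          (Ue : ∀ {Δ ρ} → Wk Δ ρ Γ → LR′ N rec Δ i (ren ρ U) (ren ρ U')) →
          (Te : ∀ {Δ ρ} (w : Wk Δ ρ Γ) {u u'} → Elₐ a (Ue (Wk-res a w)) u u' →
                LR′ N rec Δ j (ren (liftRen ρ) T [ u ]) (ren (liftRen ρ) T' [ u' ])) →
          LR′ N rec Γ k A B

El {rec = rec} {Γ} (sortᵣ {j} p _ _) t t' = rec j p Γ t t'
El {Γ = Γ} {A = A} (neᵣ _ _ _ _ _) t t' = Γ ⊢ t ≈ t' ∶ A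
El {Γ = Γ} {A = A} (piᵣ {a} _ _ _ Ue Te) t t' =
  Γ ⊢ t ≈ t' ∶ A ×
  (∀ {Δ ρ} (w : Wk Δ ρ Γ) {u u'} (x : Elₐ a (Ue (Wk-res a w)) u u') →
     El (Te w x) (app a (ren ρ t) u) (app a (ren ρ t') u'))

Elₐ rel R u u' = El R u u'
Elₐ irr R u u' = El R u u × El R u' u'

-- Recursion on the bound makes the universes well-founded: below `suc N`, universe `N` is `LR′ N`
-- over the smaller ones, and these are found recursively.
LRrec : ∀ N j → j <′ N → Ctx → Tm → Tm → Set
LRrec (suc N) .N ≤′-refl     Γ = LR′ N (LRrec N) Γ N
LRrec (suc N) j  (≤′-step p) Γ = LRrec N j p Γ

LR : ℕ → Ctx → ℕ → Tm → Tm → Set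
LR N = LR′ N (LRrec N)

-- A `≤′-step` only forwards to a smaller bound, so a universe means the same under every bound.
rec→LR : ∀ {N j} (p : j <′ N) {Γ A B} → LRrec N j p Γ A B → LR j Γ j A B
rec→LR {suc N} ≤′-refl     R = R
rec→LR {suc N} (≤′-step p) R = rec→LR p R

LR→rec : ∀ {N j} (p : j <′ N) {Γ A B} → LR j Γ j A B → LRrec N j p Γ A B
LR→rec {suc N} ≤′-refl     R = R
LR→rec {suc N} (≤′-step p) R = LR→rec p R

Elₐ-map : ∀ a {N N' Γ k k' A A' B B'} {R : LR N (res a Γ) k A B} {R' : LR N' (res a Γ) k' A' B'} →
          (∀ {t t'} → El R t t' → El R' t t') → ∀ {t t'} → Elₐ a R t t' → Elₐ a R' t t'
Elₐ-map rel f x       = f x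
Elₐ-map irr f (x , y) = f x , f y

Elₐ-swap : ∀ a {N N' Γ k k' A A' B B'} {R : LR N (res a Γ) k A B} {R' : LR N' (res a Γ) k' A' B'} →
           (∀ {t t'} → El R t t' → El R' t' t) → ∀ {t t'} → Elₐ a R t t' → Elₐ a R' t' t
Elₐ-swap rel f x       = f x
Elₐ-swap irr f (x , y) = f y , f x

-- Escape, and independence of the derivation

escape : ∀ {N Γ k A B} → LR N Γ k A B → Γ ⊢ A ≈ B ∶ sort k
escape (sortᵣ p r s)     = ≈-trans (r .conv) (≈-sym (s .conv))
escape (neᵣ n n' r s e)  = ≈-trans (r .conv) (≈-trans e (≈-sym (s .conv)))
escape (piᵣ r s e Ue Te) = ≈-trans (r .conv) (≈-trans e (≈-sym (s .conv)))

escapeEl : ∀ {N Γ k A B} (R : LR N Γ k A B) {t t'} → El R t t' → Γ ⊢ t ≈ t' ∶ A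
escapeEl (sortᵣ p r s)     x = ≈-conv (escape (rec→LR p x)) (≈-sym (r .conv))
escapeEl (neᵣ n n' r s e)  x = x
escapeEl (piᵣ r s e Ue Te) x = proj₁ x

-- `El` depends only on the left type, whose weak head normal form is determined; bounds, levels and
-- right types may differ. Both directions are proved at once because domains occur contravariantly.
irrel : ∀ {N N' Γ k k' A A' B B'} (R : LR N Γ k A B) (R' : LR N' Γ k' A' B') → A ≐ A' →
        (∀ {t t'} → El R t t' → El R' t t') × (∀ {t t'} → El R' t t' → El R t t')
irrel (sortᵣ p r s) (sortᵣ p' r' s') refl with whnf-det w-sort w-sort (r .red) (r' .red)
... | refl = (λ x → LR→rec p' (rec→LR p x)) , (λ x → LR→rec p (rec→LR p' x))
irrel (neᵣ n n' r s e) (neᵣ _ _ _ _ _) refl = (λ x → x) , (λ x → x)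
irrel {Γ = Γ} (piᵣ {a} {i} {U = U} {T = T} r s e Ue Te) (piᵣ r' s' e' Ue' Te') refl
  with whnf-det w-pi w-pi (r .red) (r' .red)
... | refl =
  (λ (c , h) → c , λ w x →
     let y = Elₐ-map a {R = Ue' _} {Ue _} (proj₂ (irrel (Ue _) (Ue' _) refl)) x
     in proj₁ (irrel (Te w y) (Te' w x) refl) (h w y)) ,
  (λ (c , h) → c , λ w x →
     let y = Elₐ-map a {R = Ue _} {Ue' _} (proj₁ (irrel (Ue _) (Ue' _) refl)) x
     in proj₂ (irrel (Te w x) (Te' w y) refl) (h w y))
irrel (sortᵣ p r s) (neᵣ n _ r' _ _) refl =
  ⊥-elim (ne≢sort n (whnf-det (w-ne n) w-sort (r' .red) (r .red)))
irrel (neᵣ n _ r' _ _) (sortᵣ p r s) refl =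
  ⊥-elim (ne≢sort n (whnf-det (w-ne n) w-sort (r' .red) (r .red)))
irrel (piᵣ r s e Ue Te) (neᵣ n _ r' _ _) refl =
  ⊥-elim (ne≢pi n (whnf-det (w-ne n) w-pi (r' .red) (r .red)))
irrel (neᵣ n _ r' _ _) (piᵣ r s e Ue Te) refl =
  ⊥-elim (ne≢pi n (whnf-det (w-ne n) w-pi (r' .red) (r .red)))
irrel (sortᵣ p r s) (piᵣ r' s' e Ue Te) refl with whnf-det w-sort w-pi (r .red) (r' .red)
... | ()
irrel (piᵣ r' s' e Ue Te) (sortᵣ p r s) refl with whnf-det w-sort w-pi (r .red) (r' .red)
... | ()

irrelˡ : ∀ {N N' Γ k k' A A' B B'} (R : LR N Γ k A B) (R' : LR N' Γ k' A' B') → A ≐ A' →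
         ∀ {t t'} → El R t t' → El R' t t'
irrelˡ R R' e = proj₁ (irrel R R' e)

irrelₐ : ∀ a {N N' Γ k k' A A' B B'} (R : LR N (res a Γ) k A B) (R' : LR N' (res a Γ) k' A' B') →
         A ≐ A' → ∀ {t t'} → Elₐ a R t t' → Elₐ a R' t t'
irrelₐ a R R' e = Elₐ-map a {R = R} {R'} (irrelˡ R R' e)

-- Symmetry and transitivity

symLR  : ∀ {N Γ k A B} → LR N Γ k A B → LR N Γ k B A
symEl  : ∀ {N Γ k A B} (R : LR N Γ k A B) → ∀ {t t'} → El R t t' → El (symLR R) t' t
-- `symLR` itself needs this direction: at a function type it turns an argument of the flipped
-- domain back into one of the original domain.
symEl⁻ : ∀ {N Γ k A B} (R : LR N Γ k A B) → ∀ {t t'} → El (symLR R) t t' → El R t' t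
symRec : ∀ N {j} (p : j <′ N) {Γ A B} → LRrec N j p Γ A B → LRrec N j p Γ B A

symLR (sortᵣ p r s)     = sortᵣ p s r
symLR (neᵣ n n' r s e)  = neᵣ n' n s r (≈-sym e)
symLR (piᵣ {a} r s e Ue Te) =
  piᵣ s r (≈-sym e) (λ w → symLR (Ue w))
    (λ w x → symLR (Te w (Elₐ-swap a {R = symLR (Ue _)} {Ue _} (symEl⁻ (Ue _)) x)))

symEl {N} (sortᵣ p r s) x = symRec N p x
symEl R@(neᵣ n n' r s e) x = ≈-conv (≈-sym x) (escape R)
symEl R@(piᵣ {a} r s e Ue Te) (c , h) =
  ≈-conv (≈-sym c) (escape R) ,
  λ w x → let y = Elₐ-swap a {R = symLR (Ue _)} {Ue _} (symEl⁻ (Ue _)) x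
          in symEl (Te w y) (h w y)

symEl⁻ {N} (sortᵣ p r s) x = symRec N p x
symEl⁻ R@(neᵣ n n' r s e) x = ≈-conv (≈-sym x) (≈-sym (escape R))
symEl⁻ R@(piᵣ {a} r s e Ue Te) (c , h) =
  ≈-conv (≈-sym c) (≈-sym (escape R)) ,
  λ w x → let y = Elₐ-swap a {R = Ue _} {symLR (Ue _)} (symEl (Ue _)) x
              -- `z` is `x` flipped twice, possibly another proof of the same relation, so the
              -- codomains at `z` and `x` are matched by `irrelˡ`.
              z = Elₐ-swap a {R = symLR (Ue _)} {Ue _} (symEl⁻ (Ue _)) y
          in irrelˡ (Te w z) (Te w x) refl (symEl⁻ (Te w z) (h w y))

symRec (suc N) ≤′-refl     R = symLR R
symRec (suc N) (≤′-step p) R = symRec N p R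

-- Flipping both derivations turns the shared right type into a shared left type.
irrelʳ : ∀ {N N' Γ k k' A A' B B'} (R : LR N Γ k A B) (R' : LR N' Γ k' A' B') → B ≐ B' →
         ∀ {t t'} → El R t t' → El R' t t'
irrelʳ R R' e x = symEl⁻ R' (irrelˡ (symLR R) (symLR R') e (symEl R x))

-- Types and terms are composed together, since composing codomains needs reflexive arguments and
-- `diagLR` obtains these by composing terms. The level `k` is shared because equalities compose
-- only at a fixed sort.
transLR  : ∀ {N N' Γ k A B C} (R : LR N Γ k A B) (R' : LR N' Γ k B C) →
           Σ (LR N Γ k A C) λ R'' → ∀ {t t' t''} → El R t t' → El R' t' t'' → El R'' t t''
transRec : ∀ N {j} (p : j <′ N) {Γ A B C} → LRrec N j p Γ A B → LR j Γ j B C → LRrec N j p Γ A C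
diagLR   : ∀ {N Γ k A B} (R : LR N Γ k A B) → ∀ {t t'} → El R t t' → El R t t
diagₐ    : ∀ a {N Γ k A B} (R : LR N (res a Γ) k A B) → ∀ {t t'} → Elₐ a R t t' → Elₐ a R t t

transLR {N} (sortᵣ p r s) (sortᵣ p' r' s') with whnf-det w-sort w-sort (s .red) (r' .red)
... | refl = sortᵣ p r s' , λ x y → transRec N p x (rec→LR p' y)
transLR (neᵣ n n' r s e) (neᵣ m m' r' s' e') with whnf-det (w-ne n') (w-ne m) (s .red) (r' .red)
... | refl = neᵣ n m' r s' (≈-trans e e') ,
             λ x y → ≈-trans x (≈-conv y (≈-sym (≈-trans (r .conv) (≈-trans e (≈-sym (s .conv))))))
transLR {N} {Γ = Γ} {k} R₁@(piᵣ {a} {i} {j} {U} {_} {T} r s e Ue Te) R₂@(piᵣ {U' = U''} {T'} {T''} r' s' e' Ue' Te')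
  with whnf-det w-pi w-pi (s .red) (r' .red)
... | refl = piᵣ r s' (≈-trans e e') Ue'' Te'' ,
             λ (c , h) (c' , h') →
               ≈-trans c (≈-conv c' (≈-sym (escape R₁))) ,
               λ w x → proj₂ (transLR (Te w (x₁ w x)) (Te' w (x₂ w x))) (h w (x₁ w x)) (h' w (x₂ w x))
  where
  Ue'' : ∀ {Δ ρ} → Wk Δ ρ Γ → LR N Δ i (ren ρ U) (ren ρ U'')
  Ue'' w = proj₁ (transLR (Ue w) (Ue' w))
  -- The composite passes through the middle codomain at `u`: the first leg uses the pair `u`, `u`
  -- and the second the pair `u`, `u'`.
  x₁ : ∀ {Δ ρ} (w : Wk Δ ρ Γ) {u u'} → Elₐ a (Ue'' (Wk-res a w)) u u' → Elₐ a (Ue (Wk-res a w)) u u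
  x₁ w x = diagₐ a (Ue (Wk-res a w)) (irrelₐ a (Ue'' (Wk-res a w)) (Ue (Wk-res a w)) refl x)
  x₂ : ∀ {Δ ρ} (w : Wk Δ ρ Γ) {u u'} → Elₐ a (Ue'' (Wk-res a w)) u u' → Elₐ a (Ue' (Wk-res a w)) u u'
  x₂ w x = Elₐ-map a {R = Ue'' (Wk-res a w)} {Ue' (Wk-res a w)}
             (irrelʳ (Ue'' (Wk-res a w)) (Ue' (Wk-res a w)) refl) x
  Te'' : ∀ {Δ ρ} (w : Wk Δ ρ Γ) {u u'} → Elₐ a (Ue'' (Wk-res a w)) u u' →
         LR N Δ j (ren (liftRen ρ) T [ u ]) (ren (liftRen ρ) T'' [ u' ])
  Te'' w x = proj₁ (transLR (Te w (x₁ w x)) (Te' w (x₂ w x)))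
transLR (sortᵣ p r s) (neᵣ n _ r' _ _) =
  ⊥-elim (ne≢sort n (whnf-det (w-ne n) w-sort (r' .red) (s .red)))
transLR (neᵣ _ n _ r' _) (sortᵣ p r s) =
  ⊥-elim (ne≢sort n (whnf-det (w-ne n) w-sort (r' .red) (r .red)))
transLR (piᵣ r s e Ue Te) (neᵣ n _ r' _ _) =
  ⊥-elim (ne≢pi n (whnf-det (w-ne n) w-pi (r' .red) (s .red)))
transLR (neᵣ _ n _ r' _) (piᵣ r s e Ue Te) =
  ⊥-elim (ne≢pi n (whnf-det (w-ne n) w-pi (r' .red) (r .red)))
transLR (sortᵣ p r s) (piᵣ r' s' e Ue Te) with whnf-det w-sort w-pi (s .red) (r' .red)
... | ()
transLR (piᵣ r' s' e Ue Te) (sortᵣ p r s) with whnf-det w-sort w-pi (r .red) (s' .red)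
... | ()

transRec (suc N) ≤′-refl     R R' = proj₁ (transLR R R')
transRec (suc N) (≤′-step p) R R' = transRec N p R R'

diagLR R x = let (R' , f) = transLR R (symLR R) in irrelˡ R' R refl (f x (symEl R x))

diagₐ rel R x       = diagLR R x
diagₐ irr R (x , y) = x , x

diagLRʳ : ∀ {N Γ k A B} (R : LR N Γ k A B) → ∀ {t t'} → El R t t' → El R t' t'
diagLRʳ R x = symEl⁻ R (diagLR (symLR R) (symEl R x))

diagₐʳ : ∀ a {N Γ k A B} (R : LR N (res a Γ) k A B) → ∀ {t t'} → Elₐ a R t t' → Elₐ a R t' t'
diagₐʳ rel R x       = diagLRʳ R x
diagₐʳ irr R (x , y) = y , y

escapeₐ : ∀ a {N Γ k A B} (R : LR N (res a Γ) k A B) {t t'} → Elₐ a R t t' → Γ ⊢ t ≈ t' ∈[ a ] A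
escapeₐ rel R x with escapeEl R x
... | mk≈ d d' e = mk≈ₐ (ann-rel d) (ann-rel d') (eqann-rel e)
escapeₐ irr R (x , y) with escapeEl R x .lhs | escapeEl R y .lhs
... | d | d' = mk≈ₐ (ann-irr d) (ann-irr d') (eqann-irr d d')

-- Monotonicity under renaming

castLR : ∀ {N Γ k A A' B B'} → A ≐ A' → B ≐ B' → LR N Γ k A B → LR N Γ k A' B'
castLR refl refl R = R

castEl : ∀ {N Γ k A B} (R : LR N Γ k A B) {t s t' s'} → t ≐ s → t' ≐ s' → El R t t' → El R s s'
castEl R refl refl x = x

monLR  : ∀ {N Γ Δ ρ k A B} → LR N Γ k A B → Wk Δ ρ Γ → LR N Δ k (ren ρ A) (ren ρ B)
monLR (sortᵣ p r s)    w = sortᵣ p (↘-ren w r) (↘-ren w s)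
monLR (neᵣ n n' r s e) w = neᵣ (ne-ren n) (ne-ren n') (↘-ren w r) (↘-ren w s) (≈-ren w e)
monLR (piᵣ {a} {U = U} {U'} {T} {T'} r s e Ue Te) w =
  piᵣ (↘-ren w r) (↘-ren w s) (≈-ren w e)
    (λ w' → castLR (sym (ren-ren U)) (sym (ren-ren U')) (Ue (Wk-∘ w w')))
    (λ w' x → castLR (sym (ren-ren-lift-[] T)) (sym (ren-ren-lift-[] T'))
                (Te (Wk-∘ w w')
                    -- Resurrecting before or after composing renamings gives different `Wk` proofs
                    -- over the same map, hence different derivations for the domain.
                    (irrelₐ a (castLR (sym (ren-ren U)) (sym (ren-ren U')) (Ue (Wk-∘ w (Wk-res a w'))))
                              (Ue (Wk-res a (Wk-∘ w w'))) (ren-ren U) x)))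

monEl  : ∀ {N Γ Δ ρ k A B} (R : LR N Γ k A B) (w : Wk Δ ρ Γ) {t t'} →
         El R t t' → El (monLR R w) (ren ρ t) (ren ρ t')
monRec : ∀ N {j} (p : j <′ N) {Γ Δ ρ A B} → Wk Δ ρ Γ →
         LRrec N j p Γ A B → LRrec N j p Δ (ren ρ A) (ren ρ B)

monEl {N} (sortᵣ p r s) w x = monRec N p w x
monEl (neᵣ n n' r s e)  w x = ≈-ren w x
monEl {ρ = ρ} (piᵣ {a} {U = U} {U'} {T} {T'} r s e Ue Te) w {t} {t'} (c , h) =
  ≈-ren w c ,
  λ w' x →
    let y = irrelₐ a (castLR (sym (ren-ren U)) (sym (ren-ren U')) (Ue (Wk-∘ w (Wk-res a w'))))
                     (Ue (Wk-res a (Wk-∘ w w'))) (ren-ren U) x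
        R = castLR (sym (ren-ren-lift-[] T)) (sym (ren-ren-lift-[] T')) (Te (Wk-∘ w w') y)
    in castEl R (cong (λ f → app a f _) (sym (ren-ren t))) (cong (λ f → app a f _) (sym (ren-ren t')))
         (irrelˡ (Te (Wk-∘ w w') y) R (sym (ren-ren-lift-[] T)) (h (Wk-∘ w w') y))

monRec (suc N) ≤′-refl     w R = monLR R w
monRec (suc N) (≤′-step p) w R = monRec N p w R

-- Neutrality survives renaming and application, so at a function type the claim passes to the
-- codomain; at a universe the terms are related as neutral types. This makes variables reducible.
reflect : ∀ {N Γ k A B n n'} (R : LR N Γ k A B) → Ne n → Ne n' → Γ ⊢ n ≈ n' ∶ A → El R n n'
reflect (sortᵣ p r s) n n' e =
  let e' = ≈-conv e (r .conv)
  in LR→rec p (neᵣ n n' (mk↘ ⇒*-refl (≈-refl (e' .lhs))) (mk↘ ⇒*-refl (≈-refl (e' .rhs))) e')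
reflect (neᵣ _ _ _ _ _) n n' e = e
reflect (piᵣ {a} r s c Ue Te) n n' e =
  e , λ w x → reflect (Te w x) (ne-app (ne-ren n)) (ne-app (ne-ren n'))
    (app-≈ (≈-conv (≈-ren w e) (≈-ren w (r .conv))) (escapeₐ a (Ue _) x)
       -- The left codomain at `u` and at `u'` both equal the right codomain at `u'`, by the pairs
       -- `u`, `u'` and `u'`, `u'`.
       (≈-trans (escape (Te w x)) (≈-sym (escape (Te w (diagₐʳ a (Ue _) x))))))

expLR : ∀ {N Γ k A A' B} → A ⇒* A' → Γ ⊢ A ≈ A' ∶ sort k → LR N Γ k A' B → LR N Γ k A B
expLR r e (sortᵣ p s s')       = sortᵣ p (↘-exp r e s) s'
expLR r e (neᵣ n n' s s' c)    = neᵣ n n' (↘-exp r e s) s' c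
expLR r e (piᵣ s s' c Ue Te)   = piᵣ (↘-exp r e s) s' c Ue Te

expEl : ∀ {N Γ k A B t t' u} (R : LR N Γ k A B) → t ⇒* t' → Γ ⊢ t ≈ t' ∶ A → El R t' u → El R t u
expEl (sortᵣ p s s') r e x = LR→rec p (expLR r (≈-conv e (s .conv)) (rec→LR p x))
expEl (neᵣ _ _ _ _ _) r e x = ≈-trans e x
expEl (piᵣ {a} s s' c Ue Te) r e (d , h) =
  ≈-trans e d ,
  λ w x → expEl (Te w x) (⇒*-app (⇒*-ren r))
    (app-≈ (≈-conv (≈-ren w e) (≈-ren w (s .conv))) (escapeₐ a (Ue _) (diagₐ a (Ue _) x))
       (≈-refl (escape (Te w x) .lhs)))
    (h w x)

-- Brings the domain and codomain of a function type, related at bounds `i` and `j`, to the common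
-- bound `i ⊔ j`.
raiseLR : ∀ {N N' Γ k A B} → N ≤′ N' → LR N Γ k A B → LR N' Γ k A B
raiseLR le (sortᵣ p r s)    = sortᵣ (≤′-trans p le) r s
raiseLR le (neᵣ n n' r s e) = neᵣ n n' r s e
raiseLR le (piᵣ {a} r s e Ue Te) =
  piᵣ r s e (λ w → raiseLR le (Ue w))
    (λ w x → raiseLR le (Te w (irrelₐ a (raiseLR le (Ue _)) (Ue _) refl x)))

-- Semantic judgements

-- Bound and level can be hidden because `irrel` makes `El` independent of them.
record Sem (a : Ann) (Δ : Ctx) (t t' A B : Tm) : Set where
  constructor sem
  field
    {bound level} : ℕ
    ty : LR bound (res a Δ) level A B
    el : Elₐ a ty t t'
open Sem

castS : ∀ {a Δ t t' s s' A A' B B'} → t ≐ s → t' ≐ s' → A ≐ A' → B ≐ B' →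
        Sem a Δ t t' A B → Sem a Δ s s' A' B'
castS refl refl refl refl x = x

symS : ∀ {a Δ t t' A B} → Sem a Δ t t' A B → Sem a Δ t' t B A
symS {a} (sem R x) = sem (symLR R) (Elₐ-swap a {R = R} {symLR R} (symEl R) x)

diagS : ∀ {a Δ t t' A B} → Sem a Δ t t' A B → Sem a Δ t t A A
diagS {a} (sem R x) = let R' = proj₁ (transLR R (symLR R))
                      in sem R' (irrelₐ a R R' refl (diagₐ a R x))

-- The levels at which two derivations prove reducibility may differ, so R' is not composed directly.
transS : ∀ {Δ t t' t'' A B C} → Sem rel Δ t t' A B → Sem rel Δ t' t'' B C → Sem rel Δ t t'' A B
transS (sem R x) (sem R' y) =
  let (D , _) = transLR (symLR R) R
      (R'' , f) = transLR R D
  in sem R'' (f x (irrelˡ R' D refl y))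

monS : ∀ {a Δ Δ' ρ t t' A B} → Wk Δ' ρ Δ → Sem a Δ t t' A B →
       Sem a Δ' (ren ρ t) (ren ρ t') (ren ρ A) (ren ρ B)
monS {a} w (sem R x) = sem (monLR R (Wk-res-res a w)) (monElₐ a R w x)
  where
  monElₐ : ∀ a {N Γ Δ ρ k A B} (R : LR N (res a Γ) k A B) (w : Wk Δ ρ Γ) {t t'} →
           Elₐ a R t t' → Elₐ a (monLR R (Wk-res-res a w)) (ren ρ t) (ren ρ t')
  monElₐ rel R w x       = monEl R w x
  monElₐ irr R w (x , y) = monEl R (Wk-⊕⊕ w) x , monEl R (Wk-⊕⊕ w) y

-- An irrelevant pair consists of two separately reducible terms, so resurrection relates the left
-- one only to itself.
resurrectS : ∀ a {Δ t t' A B} → ⊢ Δ → Sem a Δ t t' A B → Sem rel (Δ ⊕) t t A A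
resurrectS rel {t = t} {A = A} c x =
  castS (ren-id t) (ren-id t) (ren-id A) (ren-id A) (diagS (monS (Wk-⊕ (Wk-id c)) x))
resurrectS irr c (sem R (x , y)) = diagS {rel} (sem R x)

-- At an irrelevant binding `σ` and `σ'` may hold unrelated terms, each reducible over `Δ ⊕`.
SemSub : Ctx → (σ σ' : ℕ → Tm) → Ctx → Set
SemSub Δ σ σ' ε           = ⊢ Δ
SemSub Δ σ σ' (Γ ▸ a ∶ U) =
  SemSub Δ (σ ∘ suc) (σ' ∘ suc) Γ ×
  Sem a Δ (σ zero) (σ' zero) (sub (σ ∘ suc) U) (sub (σ' ∘ suc) U)

wfSub : ∀ Γ {Δ σ σ'} → SemSub Δ σ σ' Γ → ⊢ Δ
wfSub ε           s       = s
wfSub (Γ ▸ a ∶ U) (s , _) = wfSub Γ s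

symSub : ∀ Γ {Δ σ σ'} → SemSub Δ σ σ' Γ → SemSub Δ σ' σ Γ
symSub ε           s       = s
symSub (Γ ▸ a ∶ U) (s , x) = symSub Γ s , symS x

diagSub : ∀ Γ {Δ σ σ'} → SemSub Δ σ σ' Γ → SemSub Δ σ σ Γ
diagSub ε           s       = s
diagSub (Γ ▸ a ∶ U) (s , x) = diagSub Γ s , diagS x

diagSubʳ : ∀ Γ {Δ σ σ'} → SemSub Δ σ σ' Γ → SemSub Δ σ' σ' Γ
diagSubʳ Γ s = diagSub Γ (symSub Γ s)

monSub : ∀ Γ {Δ Δ' ρ σ σ'} → Wk Δ' ρ Δ → SemSub Δ σ σ' Γ → SemSub Δ' (ren ρ ∘ σ) (ren ρ ∘ σ') Γ
monSub ε           w s       = w .wf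
monSub (Γ ▸ a ∶ U) w (s , x) = monSub Γ w s , castS refl refl (ren-sub U) (ren-sub U) (monS w x)

-- As irrelevant positions may disagree, `σ` is compared only with itself; `irrArg` therefore
-- evaluates its two terms separately.
resurrectSub : ∀ Γ {Δ σ σ'} → SemSub Δ σ σ' Γ → SemSub (Δ ⊕) σ σ (Γ ⊕)
resurrectSub ε           s       = ctx-⊕ s
resurrectSub (Γ ▸ a ∶ U) (s , x) = resurrectSub Γ s , resurrectS a (wfSub Γ s) x

lookupS : ∀ {Γ Δ σ σ' x a U} → SemSub Δ σ σ' Γ → Γ ∋ x ∶[ a ] U →
          Sem a Δ (σ x) (σ' x) (sub σ U) (sub σ' U)
lookupS (s , x) (here {U = U})    = castS refl refl (sym (sub-ren U)) (sym (sub-ren U)) x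
lookupS (s , x) (there {U = U} h) = castS refl refl (sym (sub-ren U)) (sym (sub-ren U)) (lookupS s h)

record Val (Γ : Ctx) (t t' T : Tm) : Set where
  constructor val
  field
    at : ∀ {Δ σ σ'} → SemSub Δ σ σ' Γ → Sem rel Δ (sub σ t) (sub σ' t') (sub σ T) (sub σ' T)
open Val

symV : ∀ {Γ t t' T} → Val Γ t t' T → Val Γ t' t T
symV {Γ} v .at s = symS (v .at (symSub Γ s))

transV : ∀ {Γ t t' t'' T} → Val Γ t t' T → Val Γ t' t'' T → Val Γ t t'' T
-- The first equation already passes from `σ` to `σ'`, so the second is taken at `σ'` on both sides.
transV {Γ} v v' .at s = transS (v .at s) (v' .at (diagSubʳ Γ s))

diagV : ∀ {Γ t t' T} → Val Γ t t' T → Val Γ t t T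
diagV v = transV v (symV v)

sort↘ : ∀ {Γ i} → ⊢ Γ → Γ ⊢ sort i ↘ sort i ∶ suc i
sort↘ c = mk↘ ⇒*-refl (≈-refl (ty-sort c))

mkSort : ∀ {Δ A B i} → ⊢ Δ → LR i Δ i A B → Sem rel Δ A B (sort i) (sort i)
mkSort c R = sem {bound = suc _} (sortᵣ ≤′-refl (sort↘ c) (sort↘ c)) R

unSort : ∀ {Δ A B S i} → Sem rel Δ A B (sort i) S → LR i Δ i A B
unSort (sem (sortᵣ p r s) x) with whnf-det w-sort w-sort ⇒*-refl (r .red)
... | refl = rec→LR p x
unSort (sem (neᵣ n _ r _ _) x) = ⊥-elim (ne≢sort n (whnf-det (w-ne n) w-sort (r .red) ⇒*-refl))
unSort (sem (piᵣ r s e Ue Te) x) with whnf-det w-sort w-pi ⇒*-refl (r .red)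
... | ()

-- Quantifies over R because an irrelevant argument does not determine it: its typing derivation
-- lives in the resurrected context, where related substitutions need not stay related.
record Arg (a : Ann) (Δ : Ctx) (u u' U U' : Tm) : Set where
  constructor mkArg
  field
    argEl : ∀ {N k} (R : LR N (res a Δ) k U U') → Elₐ a R u u'
open Arg

-- A `pi` is its own weak head normal form, so the type is related by `piᵣ` with these components;
-- its application clause is used at the identity renaming.
appS : ∀ {Δ f f' a i j i' j' U T U' T' u u'} →
       Sem rel Δ f f' (pi a i j U T) (pi a i' j' U' T') → Arg a Δ u u' U U' →
       Sem rel Δ (app a f u) (app a f' u') (T [ u ]) (T' [ u' ])
appS (sem (sortᵣ p r s) x) y with whnf-det w-sort w-pi (r .red) ⇒*-refl
... | ()
appS (sem (neᵣ n _ r _ _) x) y = ⊥-elim (ne≢pi n (whnf-det (w-ne n) w-pi (r .red) ⇒*-refl))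
appS {f = f} {f'} {a} {U = U} {T} {U'} {T'} (sem (piᵣ r s e Ue Te) (c , h)) y
  with whnf-det w-pi w-pi ⇒*-refl (r .red) | whnf-det w-pi w-pi ⇒*-refl (s .red)
... | refl | refl =
  let w = Wk-id (wfT (c .lhs))
      R = castLR (ren-id U) (ren-id U') (Ue (Wk-res a w))
      x = irrelₐ a R (Ue (Wk-res a w)) (sym (ren-id U)) (y .argEl R)
  in castS (cong (λ t → app a t _) (ren-id f)) (cong (λ t → app a t _) (ren-id f'))
       (ren-id-lift-[] T) (ren-id-lift-[] T') (sem (Te w x) (h w x))

escS : ∀ {Δ t t' A B} → Sem rel Δ t t' A B → Δ ⊢ t ≈ t' ∶ A
escS (sem R x) = escapeEl R x

var0 : ∀ a {Δ V} → ⊢ (Δ ▸ a ∶ V) → res a (Δ ▸ a ∶ V) ⊢ var zero ∶ wk V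
var0 rel c = ty-var c here
var0 irr c = ty-var (ctx-⊕ c) here

-- The new variable is reducible by `reflect`. Its binding is any `V` equal to `sub σ U`: `extʳ`
-- binds `sub σ' U'`, and `idSub` binds `U`.
liftSemSub : ∀ {Γ Δ σ σ' a U V N k k'} → SemSub Δ σ σ' Γ →
             LR N Δ k (sub σ U) (sub σ' U) → Δ ⊢ V ≈ sub σ U ∶ sort k' →
             SemSub (Δ ▸ a ∶ V) (liftSub σ) (liftSub σ') (Γ ▸ a ∶ U)
liftSemSub {Γ} {Δ} {σ} {σ'} {a} {U} {V} s R e =
  monSub Γ w s , castS refl refl (ren-sub U) (ren-sub U) (head a refl)
  where
  c : ⊢ (Δ ▸ a ∶ V)
  c = ctx-▸ (wfSub Γ s) (e .lhs)
  w : Wk (Δ ▸ a ∶ V) suc Δ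
  w = Wk-suc c
  x≈x : res a (Δ ▸ a ∶ V) ⊢ var zero ≈ var zero ∶ wk (sub σ U)
  x≈x = ≈-conv (≈-refl (var0 a c)) (≈-ren (Wk-res a w) e)
  R' : LR _ (res a (Δ ▸ a ∶ V)) _ (wk (sub σ U)) (wk (sub σ' U))
  R' = monLR R (Wk-res a w)
  head : ∀ b → a ≐ b → Sem a (Δ ▸ a ∶ V) (var zero) (var zero) (wk (sub σ U)) (wk (sub σ' U))
  head rel refl = sem R' (reflect R' ne-var ne-var x≈x)
  head irr refl = sem R' (reflect R' ne-var ne-var x≈x , reflect R' ne-var ne-var x≈x)

extˡ : ∀ {Γ Δ σ σ' a i U U'} → Val Γ U U' (sort i) → SemSub Δ σ σ' Γ →
       SemSub (Δ ▸ a ∶ sub σ U) (liftSub σ) (liftSub σ') (Γ ▸ a ∶ U)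
extˡ {U = U} v s =
  let R = unSort (diagV v .at s) in liftSemSub {U = U} s R (≈-refl (escape R .lhs))

-- A right-hand `pi` or `lam` is typed under its own domain, so the binding is `sub σ' U'` and both
-- substitutions lift `σ'`.
extʳ : ∀ {Γ Δ σ σ' a i U U'} → Val Γ U U' (sort i) → SemSub Δ σ σ' Γ →
       SemSub (Δ ▸ a ∶ sub σ' U') (liftSub σ') (liftSub σ') (Γ ▸ a ∶ U)
extʳ {Γ} {U = U} v s =
  let s' = diagSubʳ Γ s
  in liftSemSub {U = U} s' (unSort (diagV v .at s')) (≈-sym (escape (unSort (v .at s'))))

extArg : ∀ {Γ Δ Δ' ρ σ σ' a i U U' u u' B} → Val Γ U U' (sort i) → SemSub Δ σ σ' Γ →
         Wk Δ' ρ Δ → Sem a Δ' u u' (ren ρ (sub σ U)) B →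
         SemSub Δ' (cons u (ren ρ ∘ σ)) (cons u' (ren ρ ∘ σ')) (Γ ▸ a ∶ U)
extArg {Γ} {a = a} {U = U} v s w (sem Q x) =
  let R = monLR (unSort (diagV v .at s)) (Wk-res a w)
  in monSub Γ w s , castS refl refl (ren-sub U) (ren-sub U) (sem R (irrelₐ a Q R refl x))

piS : ∀ {Γ Δ σ σ' a i j U U' T T'} → Val Γ U U' (sort i) → Val (Γ ▸ a ∶ U) T T' (sort j) →
      SemSub Δ σ σ' Γ → LR (i ⊔ j) Δ (i ⊔ j) (sub σ (pi a i j U T)) (sub σ' (pi a i j U' T'))
piS {Γ} {Δ} {σ} {σ'} {a} {i} {j} {U} {U'} {T} {T'} vU vT s =
  piᵣ (mk↘ ⇒*-refl (≈-refl (e .lhs))) (mk↘ ⇒*-refl (≈-refl (e .rhs))) e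
    (λ w → raiseLR i≤ (monLR Uσ w))
    (λ w x → castLR (sym (ren-sub-lift-[] T)) (sym (ren-sub-lift-[] T'))
      (raiseLR j≤ (unSort (vT .at (extArg vU s w (sem (raiseLR i≤ (monLR Uσ (Wk-res a w))) x))))))
  where
  i≤ = ≤⇒≤′ (m≤m⊔n i j)
  j≤ = ≤⇒≤′ (m≤n⊔m i j)
  Uσ : LR i Δ i (sub σ U) (sub σ' U')
  Uσ = unSort (vU .at s)
  Tσ : (Δ ▸ a ∶ sub σ U) ⊢ sub (liftSub σ) T ≈ sub (liftSub σ') T' ∶ sort j
  Tσ = escape (unSort (vT .at (extˡ vU s)))
  Tσ' : (Δ ▸ a ∶ sub σ' U') ⊢ sub (liftSub σ') T ≈ sub (liftSub σ') T' ∶ sort j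
  Tσ' = escape (unSort (vT .at (extʳ vU s)))
  e : Δ ⊢ sub σ (pi a i j U T) ≈ sub σ' (pi a i j U' T') ∶ sort (i ⊔ j)
  e = mk≈ (ty-pi (escape Uσ .lhs) (Tσ .lhs)) (ty-pi (escape Uσ .rhs) (Tσ' .rhs))
          (eq-pi (escape Uσ .eq) (Tσ .eq))

-- The fundamental theorem

expElʳ : ∀ {N Γ k A B t t' u} (R : LR N Γ k A B) → t ⇒* t' → Γ ⊢ t ≈ t' ∶ B → El R u t' → El R u t
expElʳ R r e x = symEl⁻ R (expEl (symLR R) r e (symEl R x))

β-≈ : ∀ {Γ a i j U T t u} → (Γ ▸ a ∶ U) ⊢ t ∶ T → Γ ⊢ lam a U t ∶ pi a i j U T →
      Γ ⊢ u ∈[ a ] U → Γ ⊢ t [ u ] ∶ T [ u ] → Γ ⊢ app a (lam a U t) u ≈ t [ u ] ∶ T [ u ]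
β-≈ d l u r = mk≈ (ty-app l u) r (eq-β d u)

-- Applied to arguments, both abstractions β-reduce to instances of their bodies, which the last
-- premise relates; expansion on each side pulls this back.
lamEl : ∀ {N Δ k a i j U U' T T' t t'} (P : LR N Δ k (pi a i j U T) (pi a i j U' T')) →
        Δ ⊢ lam a U t ≈ lam a U' t' ∶ pi a i j U T → Δ ⊢ lam a U' t' ∶ pi a i j U' T' →
        (Δ ▸ a ∶ U) ⊢ t ∶ T → (Δ ▸ a ∶ U') ⊢ t' ∶ T' →
        Δ ⊢ U ∶ sort i → Δ ⊢ U' ∶ sort i →
        (∀ {Δ' ρ} (w : Wk Δ' ρ Δ) {u u'} → Sem a Δ' u u' (ren ρ U) (ren ρ U') →
           Sem rel Δ' (ren (liftRen ρ) t [ u ]) (ren (liftRen ρ) t' [ u' ])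
                      (ren (liftRen ρ) T [ u ]) (ren (liftRen ρ) T' [ u' ])) →
        El P (lam a U t) (lam a U' t')
lamEl (sortᵣ p r s) _ _ _ _ _ _ _ with whnf-det w-sort w-pi (r .red) ⇒*-refl
... | ()
lamEl (neᵣ n _ r _ _) _ _ _ _ _ _ _ =
  ⊥-elim (ne≢pi n (whnf-det (w-ne n) w-pi (r .red) ⇒*-refl))
lamEl {a = a} (piᵣ r s c Ue Te) e l' d d' dU dU' body
  with whnf-det w-pi w-pi ⇒*-refl (r .red) | whnf-det w-pi w-pi ⇒*-refl (s .red)
... | refl | refl = e , λ w x →
  let S  = body w (sem (Ue _) x)
      D  = Te w x
      y  = irrelˡ (S .ty) D refl (S .el)
      eu = escapeₐ a (Ue (Wk-res a w)) x
      ey = escapeEl D y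
      eu' = escapeₐ a (symLR (Ue (Wk-res a w)))
              (Elₐ-swap a {R = Ue (Wk-res a w)} {symLR (Ue (Wk-res a w))} (symEl (Ue _)) x)
  in expElʳ D (⇒*-step ⇒-β ⇒*-refl)
       (β-≈ (renT (Wk-lift w dU') d') (renT w l') (eu' .lhsₐ) (ty-conv (ey .rhs) (escape D .eq)))
       (expEl D (⇒*-step ⇒-β ⇒*-refl)
         (β-≈ (renT (Wk-lift w dU) d) (renT w (e .lhs)) (eu .lhsₐ) (ey .lhs)) y)

η-body : ∀ {Γ a i j k U T t} → Γ ⊢ t ∶ pi a i j U T → Γ ⊢ U ∶ sort k →
         (Γ ▸ a ∶ U) ⊢ app a (wk t) (var zero) ∶ T
η-body {a = a} {T = T} d dU = castT (ren-suc-lift-[] T) (ty-app (renT (Wk-suc c) d) (x a c))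
  where
  c = ctx-▸ {a = a} (wfT d) dU
  x : ∀ a {Γ U} → ⊢ (Γ ▸ a ∶ U) → (Γ ▸ a ∶ U) ⊢ var zero ∈[ a ] wk U
  x rel c = ann-rel (var0 rel c)
  x irr c = ann-irr (var0 irr c)

-- Functions are compared by applying them, and the η-expansion applied to `u'` β-reduces to `t'`,
-- renamed, applied to `u'`.
ηEl : ∀ {N Δ k a i j U U' T T' t t'} (P : LR N Δ k (pi a i j U T) (pi a i j U' T')) →
      El P t t' → El P t (lam a U' (app a (wk t') (var zero)))
ηEl (sortᵣ p r s) _ with whnf-det w-sort w-pi (r .red) ⇒*-refl
... | ()
ηEl (neᵣ n _ r _ _) _ =
  ⊥-elim (ne≢pi n (whnf-det (w-ne n) w-pi (r .red) ⇒*-refl))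
ηEl {Δ = Δ} {a = a} {i} {j} {U} {U'} {T} {T'} {t} {t'} P@(piᵣ r s c Ue Te) (e , h)
  with whnf-det w-pi w-pi ⇒*-refl (r .red) | whnf-det w-pi w-pi ⇒*-refl (s .red)
... | refl | refl = ≈-trans e (≈-conv η (≈-sym c)) , λ w {u} {u'} x →
  let D = Te w x
      y = castEl D refl (cong (λ f → app a f u') (sym (η-red t'))) (h w x)
      eu' = escapeₐ a (symLR (Ue (Wk-res a w)))
              (Elₐ-swap a {R = Ue (Wk-res a w)} {symLR (Ue (Wk-res a w))} (symEl (Ue _)) x)
  in expElʳ D (⇒*-step ⇒-β ⇒*-refl)
       (β-≈ (renT (Wk-lift w dU') b) (renT w (η .rhs)) (eu' .lhsₐ)
            (ty-conv (escapeEl D y .rhs) (escape D .eq)))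
       y
  where
  dt' : Δ ⊢ t' ∶ pi a i j U' T'
  dt' = ty-conv (e .rhs) (c .eq)
  dU' = pi-dom (c .rhs)
  b : (Δ ▸ a ∶ U') ⊢ app a (wk t') (var zero) ∶ T'
  b = η-body dt' dU'
  η : Δ ⊢ t' ≈ lam a U' (app a (wk t') (var zero)) ∶ pi a i j U' T'
  η = mk≈ dt' (ty-lam b (c .rhs)) (eq-η dt')
  η-red : ∀ {ρ u} t → ren (liftRen ρ) (wk t) [ u ] ≐ ren ρ t
  η-red {ρ} t = trans (cong _[ _ ] (sym (wk-comm t))) (wk-[] (ren ρ t))

lamV : ∀ {Γ a i j U U' T t t'} → Val Γ U U' (sort i) → Val (Γ ▸ a ∶ U) T T (sort j) →
       Val (Γ ▸ a ∶ U) t t' T → Val Γ (lam a U t) (lam a U' t') (pi a i j U T)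
lamV {Γ} {a} {i} {j} {U} {U'} {T} {t} {t'} vU vT vt .at {Δ} {σ} {σ'} s =
  sem (piS (diagV vU) vT s)
    (irrelˡ P (piS (diagV vU) vT s) refl
      (lamEl P e l' (d .lhs) (d' .rhs) (eU .lhs) (eU .rhs)
        (λ w x → castS (sym (ren-sub-lift-[] t)) (sym (ren-sub-lift-[] t'))
                       (sym (ren-sub-lift-[] T)) (sym (ren-sub-lift-[] T))
                       (vt .at (extArg vU s w x)))))
  where
  P : LR _ Δ _ (sub σ (pi a i j U T)) (sub σ' (pi a i j U' T))
  P = piS vU vT s
  eU = escape (unSort (vU .at s))
  d : (Δ ▸ a ∶ sub σ U) ⊢ sub (liftSub σ) t ≈ sub (liftSub σ') t' ∶ sub (liftSub σ) T
  d = escS (vt .at {σ' = liftSub σ'} (extˡ vU s))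
  d' : (Δ ▸ a ∶ sub σ' U') ⊢ sub (liftSub σ') t ≈ sub (liftSub σ') t' ∶ sub (liftSub σ') T
  d' = escS (vt .at {σ' = liftSub σ'} (extʳ vU s))
  l' : Δ ⊢ sub σ' (lam a U' t') ∶ sub σ' (pi a i j U' T)
  l' = ty-lam (d' .rhs) (escape P .rhs)
  e : Δ ⊢ sub σ (lam a U t) ≈ sub σ' (lam a U' t') ∶ sub σ (pi a i j U T)
  e = mk≈ (ty-lam (d .lhs) (escape P .lhs)) (ty-conv l' (eq-sym (escape P .eq)))
          (eq-lam (eU .eq) (pi-cod (escape P .lhs)) (d .eq))

-- Carried through `valid` for the rule β, which gives no derivation for its domain.
ValCtx : Ctx → Set
ValCtx ε           = ⊤
ValCtx (Γ ▸ a ∶ U) = ValCtx Γ × ∃ λ k → Val Γ U U (sort k)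

-- Records what the case of `ty-lam` reads off its premise about `pi`: validity of the domain and of
-- the codomain.
Components : Ctx → Tm → Set
Components Γ (pi a i j U T) = Val Γ U U (sort i) × Val (Γ ▸ a ∶ U) T T (sort j)
Components Γ _              = ⊤

record ValArg (a : Ann) (Γ : Ctx) (u u' U : Tm) : Set where
  constructor valArg
  field
    atₐ : ∀ {Δ σ σ'} → SemSub Δ σ σ' Γ → Arg a Δ (sub σ u) (sub σ' u') (sub σ U) (sub σ' U)
open ValArg

resLR : ∀ a {N Δ k A B} → ⊢ Δ → LR N Δ k A B → LR N (res a Δ) k A B
resLR a {A = A} {B} c R = castLR (ren-id A) (ren-id B) (monLR R (Wk-res a (Wk-id c)))

expS : ∀ {Δ t t' u A B} → t ⇒* t' → Δ ⊢ t ≈ t' ∶ A → Sem rel Δ t' u A B → Sem rel Δ t u A B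
expS r e (sem R x) = sem R (expEl R r e x)

βV : ∀ {Γ a i U T t u} → Val Γ U U (sort i) → Val (Γ ▸ a ∶ U) t t T → ValArg a Γ u u U →
     Val Γ (app a (lam a U t) u) (t [ u ]) (T [ u ])
βV {Γ} {a} {i} {U} {T} {t} {u} vU vt vu .at {Δ} {σ} {σ'} s =
  castS refl (sym (sub-[] t)) (sym (sub-[] T)) (sym (sub-[] T))
    (expS (⇒*-step ⇒-β ⇒*-refl) β S')
  where
  Uσ = unSort (vU .at s)
  R  = resLR a (wfSub Γ s) Uσ
  x  = vu .atₐ s .argEl R
  S' : Sem rel Δ (sub (liftSub σ) t [ sub σ u ]) (sub (cons (sub σ' u) σ') t)
                (sub (cons (sub σ u) σ) T) (sub (cons (sub σ' u) σ') T)
  S' = castS (sym (sub-lift-[] t)) refl refl refl (vt .at (s , sem R x))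
  T≐ : sub (liftSub σ) T [ sub σ u ] ≐ sub (cons (sub σ u) σ) T
  T≐ = sub-lift-[] T
  St = vt .at {σ' = liftSub σ'} (extˡ vU s)
  d  = escS St .lhs
  dT = escape (St .ty) .lhs
  β : Δ ⊢ app a (sub σ (lam a U t)) (sub σ u) ≈ sub (liftSub σ) t [ sub σ u ] ∶ sub (cons (sub σ u) σ) T
  β = subst (λ X → Δ ⊢ _ ≈ _ ∶ X) T≐
        (β-≈ d (ty-lam d (ty-pi (escape Uσ .lhs) dT)) (escapeₐ a R x .lhsₐ)
             (castT (sym T≐) (escS S' .lhs)))

appV : ∀ {Γ a i j U T t t' u u'} → Val Γ t t' (pi a i j U T) → ValArg a Γ u u' U → ValArg a Γ u u U →
       Val Γ (app a t u) (app a t' u') (T [ u ])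
appV {T = T} {u = u} vt vu vuu .at {Δ} {σ} {σ'} s =
  let S  = appS (vt .at s) (vu .atₐ s)
      -- `S` has `u'` in its right type, whereas `Val` wants `T [ u ]` on both sides. `S'` has that
      -- type and shares its left type with `S`.
      S' = appS (diagV vt .at s) (vuu .atₐ s)
      T≐ = λ {σ} → trans (sub-lift-[] {σ} {sub σ u} T) (sym (sub-[] T))
  in castS refl refl T≐ T≐ (sem (S' .ty) (irrelˡ (S .ty) (S' .ty) refl (S .el)))

convV : ∀ {Γ t t' T T' k} → Val Γ t t' T → Val Γ T T' (sort k) → Val Γ t t' T'
convV vt vT .at s =
  let S = vt .at s
      C = unSort (vT .at s)
      D = unSort (diagV (symV vT) .at s)
  -- `C` shares its left type with `S` and its right type with `D`.
  in sem D (irrelʳ C D refl (irrelˡ (S .ty) C refl (S .el)))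

ηV : ∀ {Γ a i j U T t} → Val Γ t t (pi a i j U T) →
     Val Γ t (lam a U (app a (wk t) (var zero))) (pi a i j U T)
ηV {t = t} v .at s =
  let S = v .at s
  in castS refl (cong (λ x → lam _ _ (app _ x _)) (sym (wk-sub t))) refl refl
       (sem (S .ty) (ηEl (S .ty) (S .el)))

relArg : ∀ {Γ u u' U} → Val Γ u u' U → ValArg rel Γ u u' U
relArg v .atₐ s .argEl R = let S = v .at s in irrelˡ (S .ty) R refl (S .el)

irrArg : ∀ {Γ u u' U} → Val (Γ ⊕) u u U → Val (Γ ⊕) u' u' U → ValArg irr Γ u u' U
irrArg {Γ} v v' .atₐ s .argEl R =
  let S  = v .at (resurrectSub Γ s)
      S' = v' .at (resurrectSub Γ (symSub Γ s))
  in irrelˡ (S .ty) R refl (S .el) , irrelʳ (S' .ty) R refl (S' .el)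

valid-ctx   : ∀ {Γ} → ⊢ Γ → ValCtx Γ
valid       : ∀ {Γ t T} → Γ ⊢ t ∶ T → ValCtx Γ × Val Γ t t T × Components Γ t
valid-eq    : ∀ {Γ t t' T} → Γ ⊢ t ≡ t' ∶ T → ValCtx Γ × Val Γ t t' T
valid-arg   : ∀ {Γ a u U} → Γ ⊢ u ∈[ a ] U → ValArg a Γ u u U
valid-eqarg : ∀ {Γ a u u' U} → Γ ⊢ u ≡ u' ∈[ a ] U → ValArg a Γ u u' U × ValArg a Γ u u U

valid-ctx ctx-ε       = tt
valid-ctx (ctx-▸ c d) = valid-ctx c , _ , proj₁ (proj₂ (valid d))

valid {Γ} (ty-sort c) =
  valid-ctx c ,
  val (λ s → let c' = wfSub Γ s in mkSort c' (sortᵣ ≤′-refl (sort↘ c') (sort↘ c'))) , tt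
valid {Γ} (ty-pi d e) with valid d | valid e
... | c , vU , _ | _ , vT , _ = c , val (λ s → mkSort (wfSub Γ s) (piS vU vT s)) , vU , vT
valid (ty-var c h) = valid-ctx c , val (λ s → lookupS s h) , tt
valid (ty-lam d p) with valid d | valid p
... | _ , vt , _ | c , _ , vU , vT = c , lamV vU vT vt , tt
valid (ty-app d e) with valid d | valid-arg e
... | c , vt , _ | vu = c , appV vt vu vu , tt
valid (ty-conv d e) with valid d | valid-eq e
... | c , v , vs | _ , w = c , convV v w , vs

valid-eq (eq-β d e) with valid d
... | (c , _ , vU) , vt , _ = c , βV vU vt (valid-arg e)
valid-eq (eq-η d) with valid d
... | c , v , _ = c , ηV v
valid-eq (eq-refl d) with valid d
... | c , v , _ = c , v
valid-eq (eq-sym d) with valid-eq d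
... | c , v = c , symV v
valid-eq (eq-trans d e) with valid-eq d | valid-eq e
... | c , v | _ , w = c , transV v w
valid-eq {Γ} (eq-pi d e) with valid-eq d | valid-eq e
... | c , vU | _ , vT = c , val (λ s → mkSort (wfSub Γ s) (piS vU vT s))
valid-eq (eq-lam d p e) with valid-eq d | valid p | valid-eq e
... | c , vU | _ , vT , _ | _ , vt = c , lamV vU vT vt
valid-eq (eq-app d e) with valid-eq d | valid-eqarg e
... | c , v | vu , vuu = c , appV v vu vuu
valid-eq (eq-conv d e) with valid-eq d | valid-eq e
... | c , v | _ , w = c , convV v w

valid-arg (ann-rel d) = relArg (proj₁ (proj₂ (valid d)))
valid-arg (ann-irr d) with valid d
... | _ , v , _ = irrArg v v

valid-eqarg (eqann-rel d) with valid-eq d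
... | _ , v = relArg v , relArg (diagV v)
valid-eqarg (eqann-irr d e) with valid d | valid e
... | _ , v , _ | _ , w , _ = irrArg v w , irrArg v v

-- Instances at the identity substitution

idSub : ∀ {Γ} → ⊢ Γ → SemSub Γ var var Γ
idSub ctx-ε = ctx-ε
idSub (ctx-▸ {T = U} c d) =
  let R = unSort (proj₁ (proj₂ (valid d)) .at (idSub c))
  in liftSemSub {U = U} (idSub c) R (subst (λ X → _ ⊢ X ≈ sub var U ∶ _) (sub-var U) (escape R))

semEq : ∀ {Γ t t' T} → ⊢ Γ → Γ ⊢ t ≡ t' ∶ T → Sem rel Γ t t' T T
semEq {t = t} {t'} {T} c d =
  castS (sub-var t) (sub-var t') (sub-var T) (sub-var T) (proj₂ (valid-eq d) .at (idSub c))

semLR : ∀ {Γ A B k} → ⊢ Γ → Γ ⊢ A ≡ B ∶ sort k → LR k Γ k A B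
semLR c d = unSort (semEq c d)

-- Uniqueness

presup : ∀ {Γ t t' T} → ⊢ Γ → Γ ⊢ t ≡ t' ∶ T → Γ ⊢ t ≈ t' ∶ T
presup c d = escS (semEq c d)

type-wf : ∀ {Γ t T} → Γ ⊢ t ∶ T → ∃ λ k → Γ ⊢ T ∶ sort k
type-wf d = _ , escape (semEq (wfT d) (eq-refl d) .ty) .lhs

-- Equality of types through steps at possibly different universes; that the universes agree
-- is only known after sort-unique.
data Chain (Γ : Ctx) : Tm → Tm → Set where
  []  : ∀ {A} → Chain Γ A A
  _∷_ : ∀ {A B C k} → Γ ⊢ A ≡ B ∶ sort k → Chain Γ B C → Chain Γ A C

infixr 5 _∷_ _++_

_++_ : ∀ {Γ A B C} → Chain Γ A B → Chain Γ B C → Chain Γ A C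
[]      ++ q = q
(d ∷ p) ++ q = d ∷ (p ++ q)

reverse : ∀ {Γ A B} → Chain Γ A B → Chain Γ B A
reverse []      = []
reverse (d ∷ p) = reverse p ++ (eq-sym d ∷ [])

-- Generation: inversion of typing up to a chain of conversions

gen-sort : ∀ {Γ i S} → Γ ⊢ sort i ∶ S → Chain Γ (sort (suc i)) S
gen-sort (ty-sort c)   = []
gen-sort (ty-conv d e) = gen-sort d ++ (e ∷ [])

gen-pi : ∀ {Γ a i j U T S} → Γ ⊢ pi a i j U T ∶ S → Chain Γ (sort (i ⊔ j)) S
gen-pi (ty-pi d e)   = []
gen-pi (ty-conv d e) = gen-pi d ++ (e ∷ [])

gen-var : ∀ {Γ x S} → Γ ⊢ var x ∶ S → ∃ λ U → Γ ∋ x ∶[ rel ] U × Chain Γ U S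
gen-var (ty-var c h) = _ , h , []
gen-var (ty-conv d e) with gen-var d
... | U , h , p = U , h , p ++ (e ∷ [])

gen-lam : ∀ {Γ a U t S} → Γ ⊢ lam a U t ∶ S → ∃ λ i → ∃ λ j → ∃ λ k → ∃ λ T →
          (Γ ▸ a ∶ U) ⊢ t ∶ T × Γ ⊢ pi a i j U T ∶ sort k × Chain Γ (pi a i j U T) S
gen-lam (ty-lam d e) = _ , _ , _ , _ , d , e , []
gen-lam (ty-conv d e) with gen-lam d
... | i , j , k , T , dt , dp , p = i , j , k , T , dt , dp , p ++ (e ∷ [])

gen-app : ∀ {Γ a t u S} → Γ ⊢ app a t u ∶ S → ∃ λ i → ∃ λ j → ∃ λ U → ∃ λ T →
          Γ ⊢ t ∶ pi a i j U T × Γ ⊢ u ∈[ a ] U × Chain Γ (T [ u ]) S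
gen-app (ty-app d e) = _ , _ , _ , _ , d , e , []
gen-app (ty-conv d e) with gen-app d
... | i , j , U , T , dt , du , p = i , j , U , T , dt , du , p ++ (e ∷ [])

∋-unique : ∀ {Γ x a b U V} → Γ ∋ x ∶[ a ] U → Γ ∋ x ∶[ b ] V → U ≐ V
∋-unique here      here       = refl
∋-unique (there h) (there h') = cong wk (∋-unique h h')

-- Each step relates types of the same weak head shape, so a chain starting at a type that reduces
-- to `sort i` keeps that normal form to its end.
chain-sort : ∀ {Γ A i j} → ⊢ Γ → A ⇒* sort i → Chain Γ A (sort j) → i ≐ j
chain-sort c r [] with whnf-det w-sort w-sort r ⇒*-refl
... | refl = refl
chain-sort c r (d ∷ p) with semLR c d
... | neᵣ n _ r' _ _ = ⊥-elim (ne≢sort n (whnf-det (w-ne n) w-sort (r' .red) r))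
... | piᵣ r' _ _ _ _ with whnf-det w-sort w-pi r (r' .red)
...   | ()
chain-sort c r (d ∷ p) | sortᵣ _ r' s' with whnf-det w-sort w-sort r (r' .red)
...   | refl = chain-sort c (s' .red) p

arg-refl : ∀ {Γ a u U V N k} → ⊢ Γ → Γ ⊢ u ∈[ a ] U → (R : LR N (res a Γ) k U V) → Elₐ a R u u
arg-refl c (ann-rel d) R = let S = semEq c (eq-refl d) in irrelˡ (S .ty) R refl (S .el)
arg-refl c (ann-irr d) R =
  let S = semEq (ctx-⊕ c) (eq-refl d)
      x = irrelˡ (S .ty) R refl (S .el)
  in x , x

-- Each step is an instance of `piᵣ`, whose codomain clause at the reducible argument `u` gives the
-- corresponding step between codomains.
chain-pi : ∀ {Γ A a i j i' j' U T U' T' u} → ⊢ Γ → A ⇒* pi a i j U T → Γ ⊢ u ∈[ a ] U →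
           Chain Γ A (pi a i' j' U' T') → Chain Γ (T [ u ]) (T' [ u ])
chain-pi c r du [] with whnf-det w-pi w-pi r ⇒*-refl
... | refl = []
chain-pi c r du (d ∷ p) with semLR c d
... | neᵣ n _ r' _ _ = ⊥-elim (ne≢pi n (whnf-det (w-ne n) w-pi (r' .red) r))
... | sortᵣ _ r' _ with whnf-det w-sort w-pi (r' .red) r
...   | ()
chain-pi {u = u} c r du (d ∷ p) | piᵣ {a} {U = U} {U'} {T} {T'} r' s' _ Ue Te
  with whnf-det w-pi w-pi r (r' .red)
...   | refl = T≡T' ∷ chain-pi c (s' .red) du' p
  where
  w = Wk-id c
  R = castLR (ren-id U) (ren-id U') (Ue (Wk-res a w))
  x = arg-refl c du R
  -- Types `u` at the next domain: `escapeₐ` reads the left type, so `R` is flipped first.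
  du' = escapeₐ a (symLR R) (Elₐ-swap a {R = R} {symLR R} (symEl R) x) .lhsₐ
  T≡T' = escape (castLR (ren-id-lift-[] T) (ren-id-lift-[] T')
           (Te w (irrelₐ a R (Ue (Wk-res a w)) (sym (ren-id U)) x))) .eq

unique-var : ∀ {Γ x T T'} → Γ ⊢ var x ∶ T → Γ ⊢ var x ∶ T' → Chain Γ T T'
unique-var d d' with gen-var d | gen-var d'
... | _ , h , p | _ , h' , p' with ∋-unique h h'
... | refl = reverse p ++ p'

-- Uniqueness for the head is a parameter so that both `unique-ne` and `unique` can supply it.
unique-app : ∀ {Γ a t u S S'} → (∀ {T T'} → Γ ⊢ t ∶ T → Γ ⊢ t ∶ T' → Chain Γ T T') →
             Γ ⊢ app a t u ∶ S → Γ ⊢ app a t u ∶ S' → Chain Γ S S'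
unique-app f d d' with gen-app d | gen-app d'
... | _ , _ , _ , _ , dt , du , p | _ , _ , _ , _ , dt' , _ , p' =
  reverse p ++ chain-pi (wfT d) ⇒*-refl du (f dt dt') ++ p'

unique-ne : ∀ {Γ n T T'} → Ne n → Γ ⊢ n ∶ T → Γ ⊢ n ∶ T' → Chain Γ T T'
unique-ne ne-var     = unique-var
unique-ne (ne-app n) = unique-app (unique-ne n)

whnf-of : ∀ {Γ A k} → Γ ⊢ A ∶ sort k → ∃ λ M → Whnf M × A ⇒* M × Γ ⊢ M ∶ sort k
whnf-of d with semLR (wfT d) (eq-refl d)
... | sortᵣ _ r _    = _ , w-sort , r .red , r .conv .rhs
... | neᵣ n _ r _ _  = _ , w-ne n , r .red , r .conv .rhs
... | piᵣ r _ _ _ _  = _ , w-pi   , r .red , r .conv .rhs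

-- Both sorts carry over to the common weak head normal form, where generation or `unique-ne` yields
-- a chain between them.
sort-unique : ∀ {Γ A k k'} → Γ ⊢ A ∶ sort k → Γ ⊢ A ∶ sort k' → k ≐ k'
sort-unique d d' with whnf-of d | whnf-of d'
... | M , w , r , e | M' , w' , r' , e' with whnf-det w w' r r'
... | refl = go w e e'
  where
  c = wfT d
  go : ∀ {M k k'} → Whnf M → _ ⊢ M ∶ sort k → _ ⊢ M ∶ sort k' → k ≐ k'
  go w-sort   e e' = trans (sym (chain-sort c ⇒*-refl (gen-sort e))) (chain-sort c ⇒*-refl (gen-sort e'))
  go w-pi     e e' = trans (sym (chain-sort c ⇒*-refl (gen-pi e))) (chain-sort c ⇒*-refl (gen-pi e'))
  go (w-ne n) e e' = chain-sort c ⇒*-refl (unique-ne n e e')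

-- Each intermediate type has only one sort, so all steps lie at the same sort and `eq-trans`
-- composes them.
collapse : ∀ {Γ A B k} → Γ ⊢ A ∶ sort k → Chain Γ A B → Γ ⊢ A ≡ B ∶ sort k
collapse d [] = eq-refl d
collapse d (e ∷ p) with presup (wfT d) e
... | mk≈ l r _ with sort-unique d l
... | refl = eq-trans e (collapse r p)

unique : ∀ {Γ T T'} t → Γ ⊢ t ∶ T → Γ ⊢ t ∶ T' → Chain Γ T T'
unique (sort i)       d d' = reverse (gen-sort d) ++ gen-sort d'
unique (pi a i j U T) d d' = reverse (gen-pi d) ++ gen-pi d'
unique (var x)        d d' = unique-var d d'
unique (app a t u)    d d' = unique-app (unique t) d d'
unique (lam a U t)    d d' with gen-lam d | gen-lam d'
... | _ , _ , _ , _ , dt , dp , p | _ , _ , _ , _ , dt' , dp' , p'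
  -- A single `eq-pi` step needs equal sort annotations: the domain `U` is shared, and `e` gives the
  -- second codomain the sort of the first.
  with collapse (pi-cod dp) (unique t dt dt') | sort-unique (pi-dom dp) (pi-dom dp')
... | e | refl with sort-unique (presup (wfT dt) e .rhs) (pi-cod dp')
... | refl = reverse p ++ eq-pi (eq-refl (pi-dom dp)) e ∷ p'

theorem5p8 : ∀ {Γ t T T'} → Γ ⊢ t ∶ T → Γ ⊢ t ∶ T' → ∃ λ k → Γ ⊢ T ≡ T' ∶ sort k
theorem5p8 d d' = let (k , dT) = type-wf d in k , collapse dT (unique _ d d')
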